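{- Let $\mathcal{P}_1,\mathcal{P}_2\subset\mathbb{R}^n$ be full-dimensional rational anti-blocking polytopes and assume $\mathcal{P}_1$ is dual integral. Then for all $a,b\in\mathbb{Z}_{>0}$, \[\big|(a\mathcal{P}_1-b\mathcal{P}_2)\cap\mathbb{Z}^n\big|=\sum_{J\subseteq[n]}\big|\operatorname{relint}((a+1)\mathcal{P}_1|_J)\cap\mathbb{Z}^n\big|\cdot\big|b\mathcal{P}_2|_{J^c}\cap\mathbb{Z}^n\big|.\]
   Context: A polytope $\mathcal{P}\subseteq\mathbb{R}^n_{\ge0}$ is anti-blocking if $q\in\mathcal{P}$, $0\le p\le q$ imply $p\in\mathcal{P}$. Its associated anti-blocking polytope is $A(\mathcal{P})=\{d\in\mathbb{R}^n_{\ge0}:\langle d,x\rangle\le1\ \forall x\in\mathcal{P}\}$; $\mathcal{P}$ is dual integral if all vertices of $A(\mathcal{P})$ lie in $\mathbb{Z}^n$. For $J\subseteq[n]$, $\mathcal{P}|_J=\{x\in\mathcal{P}:x_j=0\text{ for }j\notin J\}$ (a $|J|$-dimensional face), $J^c=[n]\setminus J$, and $\operatorname{relint}$ denotes relative interior (for $J=\emptyset$, $\operatorname{relint}\{0\}=\{0\}$). -}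

module Defs where

open import Level using (0ℓ)
open import Data.Nat as ℕ using (ℕ; zero; suc)
open import Data.Integer as ℤ using (ℤ; +_)
open import Data.Rational as ℚ using (ℚ; 0ℚ; 1ℚ; _/_; _≤_; _<_; _+_; _*_; _-_; ∣_∣)
import Data.Nat.ListAction
open import Data.Bool using (Bool; true; false; not)
open import Data.Fin using (Fin)
open import Data.Vec as Vec using (Vec; []; _∷_; lookup; zipWith; replicate; foldr′)
open import Data.List as List using (List; []; _∷_; length)
open import Data.List.Relation.Unary.All using (All)
open import Data.List.Relation.Unary.Unique.Propositional using (Unique)
open import Data.List.Membership.Propositional using (_∈_)
open import Data.Product using (Σ; ∃; _×_; _,_)
open import Relation.Binary.PropositionalEquality using (_≡_)
open import Relation.Unary using (Pred)
open import Function.Bundles using (_⇔_)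

-- Points of ℚⁿ.  (All polytopes considered are rational.)
Point : ℕ → Set
Point n = Vec ℚ n

PSet : ℕ → Set₁
PSet n = Pred (Point n) 0ℓ

module _ {n : ℕ} where

  _+ᵥ_ : Point n → Point n → Point n
  _+ᵥ_ = zipWith _+_

  _-ᵥ_ : Point n → Point n → Point n
  _-ᵥ_ = zipWith _-_

  _·_ : ℚ → Point n → Point n
  c · x = Vec.map (c *_) x

  0ᵥ : Point n
  0ᵥ = replicate n 0ℚ

  ⟨_,_⟩ : Point n → Point n → ℚ
  ⟨ u , v ⟩ = foldr′ _+_ 0ℚ (zipWith _*_ u v)

  NonNeg : Point n → Set
  NonNeg x = ∀ i → 0ℚ ≤ lookup x i

  _≤ᵥ_ : Point n → Point n → Set
  p ≤ᵥ q = ∀ i → lookup p i ≤ lookup q i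

  coeffSum : List (ℚ × Point n) → ℚ
  coeffSum [] = 0ℚ
  coeffSum ((c , _) ∷ cs) = c + coeffSum cs

  combine : List (ℚ × Point n) → Point n
  combine [] = 0ᵥ
  combine ((c , p) ∷ cs) = (c · p) +ᵥ combine cs

  Conv : List (Point n) → PSet n
  Conv V x = Σ (List (ℚ × Point n)) λ cs →
    All (λ cp → (0ℚ ≤ Data.Product.proj₁ cp) × (Data.Product.proj₂ cp ∈ V)) cs
    × coeffSum cs ≡ 1ℚ × x ≡ combine cs

  Aff : PSet n → PSet n
  Aff S x = Σ (List (ℚ × Point n)) λ cs →
    All (λ cp → S (Data.Product.proj₂ cp)) cs
    × coeffSum cs ≡ 1ℚ × x ≡ combine cs

  RelInt : PSet n → PSet n
  RelInt S x = S x × Σ ℚ λ ε → (0ℚ < ε) ×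
    (∀ y → Aff S y → (∀ i → ∣ lookup x i - lookup y i ∣ < ε) → S y)

  Scale : ℚ → PSet n → PSet n
  Scale k S x = ∃ λ y → S y × x ≡ k · y

  MinkDiff : PSet n → PSet n → PSet n
  MinkDiff S T x = ∃ λ p → ∃ λ q → S p × T q × x ≡ p -ᵥ q

  Restrict : PSet n → Vec Bool n → PSet n
  Restrict S J x = S x × (∀ i → lookup J i ≡ false → lookup x i ≡ 0ℚ)

  ABDual : PSet n → PSet n
  ABDual S d = NonNeg d × (∀ x → S x → ⟨ d , x ⟩ ≤ 1ℚ)

  IsVertex : PSet n → Point n → Set
  IsVertex S x = S x × (∀ y z t → S y → S z → 0ℚ < t → t < 1ℚ →
    x ≡ (t · y) +ᵥ ((1ℚ - t) · z) → y ≡ z)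

  toℚᵥ : Vec ℤ n → Point n
  toℚᵥ = Vec.map (λ z → z / 1)

  IsIntegral : Point n → Set
  IsIntegral x = ∃ λ (z : Vec ℤ n) → x ≡ toℚᵥ z

-- A rational polytope, given by a finite list of rational points (its convex hull).
Polytope : ℕ → Set
Polytope n = List (Point n)

module _ {n : ℕ} where

  ⟦_⟧ : Polytope n → PSet n
  ⟦ V ⟧ = Conv V

  FullDimensional : Polytope n → Set
  FullDimensional P = ∀ x → Aff ⟦ P ⟧ x

  AntiBlocking : Polytope n → Set
  AntiBlocking P = (∀ x → ⟦ P ⟧ x → NonNeg x) ×
    (∀ p q → ⟦ P ⟧ q → NonNeg p → p ≤ᵥ q → ⟦ P ⟧ p)

  DualIntegral : Polytope n → Set
  DualIntegral P = ∀ d → IsVertex (ABDual ⟦ P ⟧) d → IsIntegral d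

  Lattice : PSet n → Pred (Vec ℤ n) 0ℓ
  Lattice S z = S (toℚᵥ z)

  HasCard : Pred (Vec ℤ n) 0ℓ → ℕ → Set
  HasCard L N = Σ (List (Vec ℤ n)) λ xs →
    length xs ≡ N × Unique xs × (∀ z → L z ⇔ z ∈ xs)

  complement : Vec Bool n → Vec Bool n
  complement = Vec.map not

allSubsets : (n : ℕ) → List (Vec Bool n)
allSubsets zero = [] ∷ []
allSubsets (suc n) =
  List.map (true ∷_) (allSubsets n) List.++ List.map (false ∷_) (allSubsets n)

sumSubsets : (n : ℕ) → (Vec Bool n → ℕ) → ℕ
sumSubsets n f = Data.Nat.ListAction.sum (List.map f (allSubsets n))

ℕtoℚ : ℕ → ℚ
ℕtoℚ k = (+ k) / 1

{-# OPTIONS --safe #-}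
module Submission where

-- Write z = x - y with x, y the positive and negative parts of z and J the support of x.  Since both polytopes
-- are anti-blocking, z lies in aP₁ - bP₂ iff x ∈ aP₁|_J with x_j ≥ 1 on J and y ∈ bP₂|_{Jᶜ}.  It remains to see
-- that the lattice points of relint((a+1)P₁|_J) are exactly those x.  If x is in the relative interior, then
-- (1+c)x ∈ (a+1)P₁ for some c > 0; were x ∉ aP₁, Farkas' lemma and rounding to a vertex would give a vertex m of
-- A(P₁) with ⟨m,x⟩ > a, hence ⟨m,x⟩ ≥ a+1 by integrality, contradicting (1+c)⟨m,x⟩ ≤ a+1.  Conversely, a point
-- of the face within 1/a of x is dominated by (1 + 1/a)x ∈ (a+1)P₁.

open import Defs
open import Data.Nat using (ℕ; zero; suc)
open import Data.Vec using (Vec)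
open import Data.Bool using (Bool)
open import Data.Product using (Σ; _×_)

-- A cardinality is witnessed by an explicit duplicate-free list, so every set that is counted must
-- be decidable. Relative interiors and scaled faces are not decided directly: they are rewritten as
-- sign conditions on an integer vector together with membership of that vector, divided by the
-- dilation factor, in the polytope. Farkas' lemma decides the latter, since it returns either
-- convex coefficients or a separating functional; the same decision licenses the argument by
-- contradiction. That x is positive on J in the relative interior comes from full dimension: some
-- point of P₁ has a positive j-th coordinate, and x can be moved a little against that point,
-- projected to the face, without leaving the face. The number c exists because the face contains 0,
-- so the ray through x stays in its affine hull.

module LatticeSplitting where

  import Data.Nat.Base as ℕ
  import Data.Nat.Properties as ℕ
  import Data.Nat.ListAction as ℕ
  open import Data.Bool.Base using (true; false; not; if_then_else_)
  import Data.Bool.Properties as Bool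
  import Data.Nat.Coprimality as Coprime
  open import Data.Integer.Base as ℤ using (ℤ; 0ℤ; 1ℤ)
  import Data.Integer.Properties as ℤ
  open import Data.Rational.Base
    using (ℚ; mkℚ; 0ℚ; 1ℚ; _/_; _≤_; _<_; _+_; _*_; _-_; -_; 1/_; ∣_∣; ↥_; *≤*; positive; nonNegative)
  import Data.Rational.Properties as ℚ
  open import Data.Fin.Base using (Fin; zero; suc)
  open import Data.Fin.Properties using (all?)
  open import Data.Vec.Base as Vec using ([]; _∷_; lookup)
  import Data.Vec.Properties as Vec
  open import Data.List.Base as List
    using (List; []; _∷_; _++_; length; allFin; upTo; filter; cartesianProduct; cartesianProductWith)
  open import Data.List.Properties using (length-map; length-++; map-cong)
  open import Data.List.Membership.Propositional using (_∈_)
  open import Data.List.Membership.Propositional.Properties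
    using (∈-map⁺; ∈-map⁻; ∈-++⁺ˡ; ∈-++⁺ʳ; ∈-++⁻; ∈-filter⁺; ∈-filter⁻; ∈-upTo⁺; ∈-allFin;
           ∈-cartesianProduct⁺; ∈-cartesianProduct⁻; ∈-cartesianProductWith⁺)
  open import Data.List.Relation.Binary.Permutation.Propositional using (_↭_; prep; swap; ↭-refl; ↭-trans; ↭-sym)
  open import Data.List.Relation.Binary.Permutation.Propositional.Properties
    using (All-resp-↭; ∈-resp-↭; ↭-length; shift; ++⁺ˡ)
  open import Data.List.Relation.Unary.All as All using (All; []; _∷_)
  import Data.List.Relation.Unary.All.Properties as All
  open import Data.List.Relation.Unary.AllPairs using ([]; _∷_)
  open import Data.List.Relation.Unary.Any using (here; there)
  open import Data.List.Relation.Unary.Unique.Propositional using (Unique)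
  import Data.List.Relation.Unary.Unique.Propositional.Properties as Unique
  open import Data.Product using (∃; ∃₂; _,_; proj₁; proj₂)
  open import Data.Sum.Base using (_⊎_; inj₁; inj₂)
  open import Function.Base using (_∘_)
  open import Function.Bundles using (mk⇔; Equivalence)
  open import Level using (0ℓ)
  open import Relation.Nullary using (¬_; Dec; yes; no; contradiction; dec⇒maybe; _×-dec_; _→-dec_)
  open import Relation.Nullary.Decidable using (decidable-stable)
  open import Relation.Unary using (Pred; Decidable)
  open import Relation.Binary.Definitions using (tri<; tri≈; tri>)
  open import Relation.Binary.PropositionalEquality hiding (J)
  open import Tactic.RingSolver using (solve-∀)
  open import Tactic.RingSolver.Core.AlmostCommutativeRing using (AlmostCommutativeRing; fromCommutativeRing)

  private
    variable
      n : ℕ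

  -- Ordered-field arithmetic in ℚ

  ℚ-ring : AlmostCommutativeRing 0ℓ 0ℓ
  ℚ-ring = fromCommutativeRing ℚ.+-*-commutativeRing (λ x → dec⇒maybe (0ℚ ℚ.≟ x))

  ≤-offset : ∀ {x y e} → 0ℚ ≤ e → y ≡ x + e → x ≤ y
  ≤-offset {x} {y} {e} 0≤e y≡x+e =
    subst₂ _≤_ (ℚ.+-identityʳ x) (sym y≡x+e) (ℚ.+-monoʳ-≤ x 0≤e)

  <-offset : ∀ {x y e} → 0ℚ < e → y ≡ x + e → x < y
  <-offset {x} {y} {e} 0<e y≡x+e =
    subst₂ _<_ (ℚ.+-identityʳ x) (sym y≡x+e) (ℚ.+-monoʳ-< x 0<e)

  ≤⇒0≤- : ∀ {x y} → x ≤ y → 0ℚ ≤ y - x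
  ≤⇒0≤- {x} {y} x≤y = subst (_≤ y - x) (ℚ.+-inverseʳ x) (ℚ.+-monoˡ-≤ (- x) x≤y)

  <⇒0<- : ∀ {x y} → x < y → 0ℚ < y - x
  <⇒0<- {x} {y} x<y = subst (_< y - x) (ℚ.+-inverseʳ x) (ℚ.+-monoˡ-< (- x) x<y)

  +-nonneg : ∀ {x y} → 0ℚ ≤ x → 0ℚ ≤ y → 0ℚ ≤ x + y
  +-nonneg 0≤x 0≤y = ℚ.≤-trans (ℚ.≤-reflexive (sym (ℚ.+-identityʳ 0ℚ))) (ℚ.+-mono-≤ 0≤x 0≤y)

  *-monoʳ-≤ : ∀ {c x y} → 0ℚ ≤ c → x ≤ y → c * x ≤ c * y
  *-monoʳ-≤ {c} 0≤c = ℚ.*-monoˡ-≤-nonNeg c {{nonNegative 0≤c}}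

  *-monoʳ-< : ∀ {c x y} → 0ℚ < c → x < y → c * x < c * y
  *-monoʳ-< {c} 0<c = ℚ.*-monoʳ-<-pos c {{positive 0<c}}

  *-nonneg : ∀ {x y} → 0ℚ ≤ x → 0ℚ ≤ y → 0ℚ ≤ x * y
  *-nonneg {x} {y} 0≤x 0≤y = subst (_≤ x * y) (ℚ.*-zeroʳ x) (*-monoʳ-≤ 0≤x 0≤y)

  *-pos : ∀ {x y} → 0ℚ < x → 0ℚ < y → 0ℚ < x * y
  *-pos {x} {y} 0<x 0<y = subst (_< x * y) (ℚ.*-zeroʳ x) (*-monoʳ-< 0<x 0<y)

  *-nonpos : ∀ {c x} → 0ℚ ≤ c → x ≤ 0ℚ → c * x ≤ 0ℚ
  *-nonpos {c} {x} 0≤c x≤0 = subst (c * x ≤_) (ℚ.*-zeroʳ c) (*-monoʳ-≤ 0≤c x≤0)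

  neg-involutive : ∀ p → - - p ≡ p
  neg-involutive = solve-∀ ℚ-ring

  neg-square : ∀ x → - x * - x ≡ x * x
  neg-square = solve-∀ ℚ-ring

  zero⊎square-pos : ∀ x → x ≡ 0ℚ ⊎ 0ℚ < x * x
  zero⊎square-pos x with ℚ.<-cmp x 0ℚ
  ... | tri< x<0 _ _ = inj₂ (subst (0ℚ <_) (neg-square x) (*-pos (ℚ.neg-antimono-< x<0) (ℚ.neg-antimono-< x<0)))
  ... | tri≈ _ x≡0 _ = inj₁ x≡0
  ... | tri> _ _ 0<x = inj₂ (*-pos 0<x 0<x)

  square-nonneg : ∀ x → 0ℚ ≤ x * x
  square-nonneg x with zero⊎square-pos x
  ... | inj₁ refl = ℚ.≤-refl
  ... | inj₂ 0<x² = ℚ.<⇒≤ 0<x²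

  reciprocal : ∀ {p} → 0ℚ < p → ∃ λ q → 0ℚ < q × q * p ≡ 1ℚ
  reciprocal {p} 0<p = 1/ p , ℚ.positive⁻¹ (1/ p) {{ℚ.1/pos⇒pos p}} , ℚ.*-inverseˡ p
    where
    instance
      p-pos = positive 0<p
      p-nonZero = ℚ.pos⇒nonZero p

  -- Inner products

  dot-comm : (u v : Point n) → ⟨ u , v ⟩ ≡ ⟨ v , u ⟩
  dot-comm [] [] = refl
  dot-comm (x ∷ u) (y ∷ v) = cong₂ _+_ (ℚ.*-comm x y) (dot-comm u v)

  dot-+ʳ : (u x y : Point n) → ⟨ u , x +ᵥ y ⟩ ≡ ⟨ u , x ⟩ + ⟨ u , y ⟩
  dot-+ʳ [] [] [] = refl
  dot-+ʳ (a ∷ u) (b ∷ x) (c ∷ y) =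
    trans (cong (a * (b + c) +_) (dot-+ʳ u x y)) (step a b c ⟨ u , x ⟩ ⟨ u , y ⟩)
    where
    step : ∀ a b c p q → a * (b + c) + (p + q) ≡ (a * b + p) + (a * c + q)
    step = solve-∀ ℚ-ring

  dot-·ʳ : (u : Point n) (c : ℚ) (x : Point n) → ⟨ u , c · x ⟩ ≡ c * ⟨ u , x ⟩
  dot-·ʳ [] c [] = sym (ℚ.*-zeroʳ c)
  dot-·ʳ (a ∷ u) c (b ∷ x) =
    trans (cong (a * (c * b) +_) (dot-·ʳ u c x)) (step a b c ⟨ u , x ⟩)
    where
    step : ∀ a b c p → a * (c * b) + c * p ≡ c * (a * b + p)
    step = solve-∀ ℚ-ring

  dot-0ʳ : (u : Point n) → ⟨ u , 0ᵥ ⟩ ≡ 0ℚ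
  dot-0ʳ [] = refl
  dot-0ʳ (a ∷ u) = cong₂ _+_ (ℚ.*-zeroʳ a) (dot-0ʳ u)

  ·-dot : ∀ c (u x : Point n) → ⟨ c · u , x ⟩ ≡ c * ⟨ u , x ⟩
  ·-dot c u x = trans (dot-comm _ x) (trans (dot-·ʳ x c u) (cong (c *_) (dot-comm x u)))

  dot-ray : (u x : Point n) (c : ℚ) (y : Point n) →
    ⟨ u , x +ᵥ (c · y) ⟩ ≡ ⟨ u , x ⟩ + c * ⟨ u , y ⟩
  dot-ray u x c y = trans (dot-+ʳ u x (c · y)) (cong (⟨ u , x ⟩ +_) (dot-·ʳ u c y))

  ray-dot : (x : Point n) (c : ℚ) (y u : Point n) →
    ⟨ x +ᵥ (c · y) , u ⟩ ≡ ⟨ x , u ⟩ + c * ⟨ y , u ⟩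
  ray-dot x c y u = trans (dot-comm (x +ᵥ (c · y)) u)
    (trans (dot-ray u x c y) (cong₂ (λ p q → p + c * q) (dot-comm u x) (dot-comm u y)))

  dot-self-nonneg : (x : Point n) → 0ℚ ≤ ⟨ x , x ⟩
  dot-self-nonneg [] = ℚ.≤-refl
  dot-self-nonneg (a ∷ x) = +-nonneg (square-nonneg a) (dot-self-nonneg x)

  0ᵥ⊎dot-self-pos : (x : Point n) → x ≡ 0ᵥ ⊎ 0ℚ < ⟨ x , x ⟩
  0ᵥ⊎dot-self-pos [] = inj₁ refl
  0ᵥ⊎dot-self-pos (a ∷ x) with zero⊎square-pos a | 0ᵥ⊎dot-self-pos x
  ... | inj₁ a≡0 | inj₁ x≡0 = inj₁ (cong₂ _∷_ a≡0 x≡0)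
  ... | inj₂ 0<a² | _ = inj₂ (ℚ.+-mono-<-≤ 0<a² (dot-self-nonneg x))
  ... | inj₁ _ | inj₂ 0<x = inj₂ (ℚ.+-mono-≤-< (square-nonneg a) 0<x)

  unit : Fin n → Point n
  unit zero = 1ℚ ∷ 0ᵥ
  unit (suc i) = 0ℚ ∷ unit i

  dot-unit : (x : Point n) (i : Fin n) → ⟨ x , unit i ⟩ ≡ lookup x i
  dot-unit (a ∷ x) zero =
    trans (cong₂ _+_ (ℚ.*-identityʳ a) (dot-0ʳ x)) (ℚ.+-identityʳ a)
  dot-unit (a ∷ x) (suc i) =
    trans (cong₂ _+_ (ℚ.*-zeroʳ a) (dot-unit x i)) (ℚ.+-identityˡ (lookup x i))

  -- Farkas' lemma

  data Cone (V : List (Point n)) : Point n → Set where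
    []  : Cone V 0ᵥ
    add : ∀ {c p x} → 0ℚ ≤ c → p ∈ V → Cone V x → Cone V ((c · p) +ᵥ x)

  cone-mono : ∀ {V W} {x : Point n} → (∀ {v} → v ∈ V → v ∈ W) → Cone V x → Cone W x
  cone-mono V⊆W [] = []
  cone-mono V⊆W (add 0≤c p∈V x) = add 0≤c (V⊆W p∈V) (cone-mono V⊆W x)

  -- When ⟨a,w⟩ = 1 this is the projection along `a` onto the hyperplane orthogonal to `w`.
  shear : (w a v : Point n) → Point n
  shear w a v = v +ᵥ ((- ⟨ v , w ⟩) · a)

  shear-combination : ∀ c k r (p x a : Point n) →
    ((c · p) +ᵥ (x +ᵥ ((- r) · a))) ≡
    (((c · (p +ᵥ ((- k) · a))) +ᵥ x) +ᵥ ((- (r + - c * k)) · a))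
  shear-combination c k r [] [] [] = refl
  shear-combination c k r (p ∷ ps) (x ∷ xs) (a ∷ as) =
    cong₂ _∷_ (step c k r p x a) (shear-combination c k r ps xs as)
    where
    step : ∀ c k r p x a → c * p + (x + - r * a) ≡ (c * (p + - k * a) + x) + - (r + - c * k) * a
    step = solve-∀ ℚ-ring

  0ᵥ-sheared : (a : Point n) → 0ᵥ ≡ (0ᵥ +ᵥ ((- 0ℚ) · a))
  0ᵥ-sheared [] = refl
  0ᵥ-sheared (a ∷ as) = cong₂ _∷_ (step a) (0ᵥ-sheared as)
    where
    step : ∀ a → 0ℚ ≡ 0ℚ + - 0ℚ * a
    step = solve-∀ ℚ-ring

  -- As ⟨v,w⟩ ≤ 0 on `V`, each sheared generator is `v` plus a nonnegative multiple of `a`. These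
  -- multiples add up to `r`, and removing them leaves a combination of the original generators.
  unshear-cone : ∀ {V} (w a : Point n) → (∀ {v} → v ∈ V → ⟨ v , w ⟩ ≤ 0ℚ) →
    ∀ {x} → Cone (List.map (shear w a) V) x → ∃ λ r → 0ℚ ≤ r × Cone V (x +ᵥ ((- r) · a))
  unshear-cone {V = V} w a V≤0 [] = 0ℚ , ℚ.≤-refl , subst (Cone V) (0ᵥ-sheared a) []
  unshear-cone {V = V} w a V≤0 (add {c = c} {x = x} 0≤c p∈ x∈) with ∈-map⁻ (shear w a) p∈ | unshear-cone w a V≤0 x∈
  ... | v , v∈V , refl | r , 0≤r , cone =
    r + - c * ⟨ v , w ⟩ ,
    +-nonneg 0≤r (subst (0ℚ ≤_) (step c ⟨ v , w ⟩) (*-nonneg 0≤c (ℚ.neg-antimono-≤ (V≤0 v∈V)))) ,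
    subst (Cone V) (shear-combination c ⟨ v , w ⟩ r v x a) (add 0≤c v∈V cone)
    where
    step : ∀ c k → c * - k ≡ - c * k
    step = solve-∀ ℚ-ring

  Separates : List (Point n) → Point n → Point n → Set
  Separates V b w = (∀ {v} → v ∈ V → ⟨ v , w ⟩ ≤ 0ℚ) × 0ℚ < ⟨ b , w ⟩

  unshear : ∀ k r (b a : Point n) → ((k + r) · a) +ᵥ ((b +ᵥ ((- k) · a)) +ᵥ ((- r) · a)) ≡ b
  unshear k r [] [] = refl
  unshear k r (b ∷ bs) (a ∷ as) = cong₂ _∷_ (step k r b a) (unshear k r bs as)
    where
    step : ∀ k r b a → (k + r) * a + ((b + - k * a) + - r * a) ≡ b
    step = solve-∀ ℚ-ring

  -- Bartl's induction: if w separates b from cone V but ⟨a,w⟩ = 1, shear everything along a into the hyperplane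
  -- ⟨·,w⟩ = 0 and drop a.
  farkas′ : ∀ k (V : List (Point n)) → length V ≡ k → ∀ b → Cone V b ⊎ ∃ (Separates V b)
  farkas′ k [] _ b with 0ᵥ⊎dot-self-pos b
  ... | inj₁ refl = inj₁ []
  ... | inj₂ 0<b = inj₂ (b , (λ ()) , 0<b)
  farkas′ (suc k) (a ∷ V) eq b with farkas′ k V (cong ℕ.pred eq) b
  ... | inj₁ b∈V = inj₁ (cone-mono there b∈V)
  ... | inj₂ (w₀ , V≤0 , 0<b) with ⟨ a , w₀ ⟩ ℚ.≤? 0ℚ
  ...   | yes a≤0 = inj₂ (w₀ , (λ { (here refl) → a≤0 ; (there v∈V) → V≤0 v∈V }) , 0<b)
  ...   | no a≰0 with reciprocal (ℚ.≰⇒> a≰0)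
  ...     | q , 0<q , qa≡1 =
    conclude (farkas′ k (List.map (shear w a) V) (trans (length-map _ V) (cong ℕ.pred eq)) (shear w a b))
    where
    w = q · w₀

    aw≡1 : ⟨ a , w ⟩ ≡ 1ℚ
    aw≡1 = trans (dot-·ʳ a q w₀) qa≡1

    V≤0′ : ∀ {v} → v ∈ V → ⟨ v , w ⟩ ≤ 0ℚ
    V≤0′ {v} v∈V = subst (_≤ 0ℚ) (sym (dot-·ʳ v q w₀)) (*-nonpos (ℚ.<⇒≤ 0<q) (V≤0 v∈V))

    0<b′ : 0ℚ < ⟨ b , w ⟩
    0<b′ = subst (0ℚ <_) (sym (dot-·ʳ b q w₀)) (*-pos 0<q 0<b)

    -- The map sending w′ to w′ - ⟨a,w′⟩w is the adjoint of `shear w a`, and its values are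
    -- orthogonal to `a` because ⟨a,w⟩ = 1. A functional separating the sheared data thus pulls back
    -- to one separating the original data, with `a` on its hyperplane.
    shear-dual : ∀ v w′ → ⟨ v , w′ +ᵥ ((- ⟨ a , w′ ⟩) · w) ⟩ ≡ ⟨ shear w a v , w′ ⟩
    shear-dual v w′ = trans (dot-ray v w′ (- ⟨ a , w′ ⟩) w)
      (trans (step ⟨ v , w′ ⟩ ⟨ a , w′ ⟩ ⟨ v , w ⟩) (sym (ray-dot v (- ⟨ v , w ⟩) a w′)))
      where
      step : ∀ x y z → x + - y * z ≡ x + - z * y
      step = solve-∀ ℚ-ring

    conclude : Cone (List.map (shear w a) V) (shear w a b) ⊎ ∃ (Separates (List.map (shear w a) V) (shear w a b)) →
               Cone (a ∷ V) b ⊎ ∃ (Separates (a ∷ V) b)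
    -- Undoing the shear of `b` contributes ⟨b,w⟩ to the coefficient of `a`, and undoing the shears
    -- of the generators contributes `r`. Both are nonnegative, the first because `w` was positive
    -- on `b`.
    conclude (inj₁ b∈) with unshear-cone w a V≤0′ b∈
    ... | r , 0≤r , cone = inj₁ (subst (Cone (a ∷ V)) (unshear ⟨ b , w ⟩ r b a)
            (add (+-nonneg (ℚ.<⇒≤ 0<b′) 0≤r) (here refl) (cone-mono there cone)))
    conclude (inj₂ (w′ , V≤0 , 0<b)) = inj₂ (w′ +ᵥ ((- ⟨ a , w′ ⟩) · w) , ≤0 ,
      subst (0ℚ <_) (sym (shear-dual b w′)) 0<b)
      where
      step : ∀ x → x + - x * 1ℚ ≡ 0ℚ
      step = solve-∀ ℚ-ring

      ≤0 : ∀ {v} → v ∈ a ∷ V → ⟨ v , w′ +ᵥ ((- ⟨ a , w′ ⟩) · w) ⟩ ≤ 0ℚ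
      ≤0 (here refl) = ℚ.≤-reflexive (trans (dot-ray a w′ (- ⟨ a , w′ ⟩) w)
        (trans (cong (λ t → ⟨ a , w′ ⟩ + - ⟨ a , w′ ⟩ * t) aw≡1) (step ⟨ a , w′ ⟩)))
      ≤0 {v} (there v∈V) = subst (_≤ 0ℚ) (sym (shear-dual v w′)) (V≤0 (∈-map⁺ (shear w a) v∈V))

  farkas : (V : List (Point n)) (b : Point n) → Cone V b ⊎ ∃ (Separates V b)
  farkas V = farkas′ (length V) V refl

  -- Convex hulls: separation and decidable membership

  combine-dot : (w : Point n) (β : ℚ) (cs : List (ℚ × Point n)) →
    All (λ cp → 0ℚ ≤ proj₁ cp × ⟨ w , proj₂ cp ⟩ ≤ β) cs →
    ⟨ w , combine cs ⟩ ≤ coeffSum cs * β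
  combine-dot w β [] [] = ℚ.≤-reflexive (trans (dot-0ʳ w) (sym (ℚ.*-zeroˡ β)))
  combine-dot w β ((c , p) ∷ cs) ((0≤c , p≤β) ∷ all) = subst₂ _≤_
    (sym (trans (dot-+ʳ w (c · p) (combine cs)) (cong (_+ ⟨ w , combine cs ⟩) (dot-·ʳ w c p))))
    (sym (ℚ.*-distribʳ-+ β c (coeffSum cs)))
    (ℚ.+-mono-≤ (*-monoʳ-≤ 0≤c p≤β) (combine-dot w β cs all))

  conv-dot : ∀ {V} {w : Point n} {β} → (∀ {v} → v ∈ V → ⟨ w , v ⟩ ≤ β) → ∀ {x} → Conv V x → ⟨ w , x ⟩ ≤ β
  conv-dot {w = w} {β} V≤β (cs , all , sum≡1 , refl) = subst (⟨ w , combine cs ⟩ ≤_)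
    (trans (cong (_* β) sum≡1) (ℚ.*-identityˡ β))
    (combine-dot w β cs (All.map (λ { (0≤c , p∈V) → 0≤c , V≤β p∈V }) all))

  vertex∈conv : ∀ {V} {v : Point n} → v ∈ V → Conv V v
  vertex∈conv {v = v} v∈V = (1ℚ , v) ∷ [] , (ℚ.nonNegative⁻¹ 1ℚ , v∈V) ∷ [] , refl , single v
    where
    step : ∀ x → x ≡ 1ℚ * x + 0ℚ
    step = solve-∀ ℚ-ring
    single : (v : Point n) → v ≡ ((1ℚ · v) +ᵥ 0ᵥ)
    single [] = refl
    single (x ∷ v) = cong₂ _∷_ (step x) (single v)

  -- x ∈ Conv V iff (1 , x) lies in the cone over {1} × V.
  homogenize : List (Point n) → List (Point (suc n))
  homogenize = List.map (1ℚ ∷_)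

  cone⇒combination : ∀ {V : List (Point n)} {z} → Cone (homogenize V) z →
    ∃ λ cs → All (λ cp → 0ℚ ≤ proj₁ cp × proj₂ cp ∈ V) cs × z ≡ coeffSum cs ∷ combine cs
  cone⇒combination [] = [] , [] , refl
  cone⇒combination (add {c = c} 0≤c p∈ x∈) with ∈-map⁻ (1ℚ ∷_) p∈ | cone⇒combination x∈
  ... | v , v∈V , refl | cs , all , refl =
    (c , v) ∷ cs , (0≤c , v∈V) ∷ all , cong (λ t → t + coeffSum cs ∷ ((c · v) +ᵥ combine cs)) (ℚ.*-identityʳ c)

  -- A functional on the homogenized space has one extra coordinate `w₀`; since the generators all
  -- have first entry 1, it turns into the constant `- w₀` of an affine inequality.
  conv⊎separated : (V : List (Point n)) (y : Point n) →
    Conv V y ⊎ (∃₂ λ w β → (∀ {v} → v ∈ V → ⟨ w , v ⟩ ≤ β) × β < ⟨ w , y ⟩)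
  conv⊎separated V y with farkas (homogenize V) (1ℚ ∷ y)
  ... | inj₁ cone with cone⇒combination cone
  ...   | cs , all , eq = inj₁ (cs , all , sym (cong Vec.head eq) , cong Vec.tail eq)
  conv⊎separated V y | inj₂ (w₀ ∷ w , V≤0 , 0<y) = inj₂ (w , - w₀ , bound , strict)
    where
    step : ∀ a b → - a ≡ b + - (1ℚ * a + b)
    step = solve-∀ ℚ-ring
    step′ : ∀ a b → b ≡ - a + (1ℚ * a + b)
    step′ = solve-∀ ℚ-ring
    bound : ∀ {v} → v ∈ V → ⟨ w , v ⟩ ≤ - w₀
    bound {v} v∈V = subst (_≤ - w₀) (dot-comm v w)
      (≤-offset (ℚ.neg-antimono-≤ (V≤0 (∈-map⁺ (1ℚ ∷_) v∈V))) (step w₀ ⟨ v , w ⟩))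
    strict : - w₀ < ⟨ w , y ⟩
    strict = subst (- w₀ <_) (dot-comm y w) (<-offset 0<y (step′ w₀ ⟨ y , w ⟩))

  -- The separating functional refutes membership. This decision is used both to enumerate lattice
  -- points and to remove a double negation in `integral-gap`.
  conv? : (V : List (Point n)) (y : Point n) → Dec (Conv V y)
  conv? V y with conv⊎separated V y
  ... | inj₁ y∈ = yes y∈
  ... | inj₂ (w , β , V≤β , β<y) = no λ y∈ → ℚ.<-irrefl refl (ℚ.<-≤-trans β<y (conv-dot {w = w} V≤β y∈))

  ext : {A : Set} {x y : Vec A n} → (∀ i → lookup x i ≡ lookup y i) → x ≡ y
  ext {x = []} {[]} _ = refl
  ext {x = a ∷ x} {b ∷ y} eq = cong₂ _∷_ (eq zero) (ext (eq ∘ suc))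

  lookup-0ᵥ : (i : Fin n) → lookup 0ᵥ i ≡ 0ℚ
  lookup-0ᵥ i = Vec.lookup-replicate i 0ℚ

  dot--1 : (u x : Point n) → ⟨ (- 1ℚ) · u , x ⟩ ≡ - ⟨ u , x ⟩
  dot--1 u x = trans (·-dot (- 1ℚ) u x) (step ⟨ u , x ⟩)
    where
    step : ∀ x → (- 1ℚ) * x ≡ - x
    step = solve-∀ ℚ-ring

  neg-≤0 : ∀ {x} → - x ≤ 0ℚ → 0ℚ ≤ x
  neg-≤0 {x} -x≤0 = subst (0ℚ ≤_) (neg-involutive x) (ℚ.neg-antimono-≤ -x≤0)

  -- Spanning sets and orthogonal complements

  _⊥_ : Point n → List (Point n) → Set
  w ⊥ T = ∀ {v} → v ∈ T → ⟨ v , w ⟩ ≡ 0ℚ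

  cone-⊥ : ∀ {V} {w : Point n} → w ⊥ V → ∀ {x} → Cone V x → ⟨ x , w ⟩ ≡ 0ℚ
  cone-⊥ {w = w} w⊥V [] = trans (dot-comm 0ᵥ w) (dot-0ʳ w)
  cone-⊥ {w = w} w⊥V (add {c} {p} {x} _ p∈V x∈) = begin
    ⟨ (c · p) +ᵥ x , w ⟩        ≡⟨ dot-comm _ w ⟩
    ⟨ w , (c · p) +ᵥ x ⟩        ≡⟨ dot-+ʳ w (c · p) x ⟩
    ⟨ w , c · p ⟩ + ⟨ w , x ⟩   ≡⟨ cong₂ _+_ (dot-·ʳ w c p) (dot-comm w x) ⟩
    c * ⟨ w , p ⟩ + ⟨ x , w ⟩   ≡⟨ cong (λ t → c * t + ⟨ x , w ⟩) (dot-comm w p) ⟩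
    c * ⟨ p , w ⟩ + ⟨ x , w ⟩   ≡⟨ cong₂ (λ t t′ → c * t + t′) (w⊥V p∈V) (cone-⊥ w⊥V x∈) ⟩
    c * 0ℚ + 0ℚ                 ≡⟨ step c ⟩
    0ℚ                          ∎
    where
    open ≡-Reasoning
    step : ∀ c → c * 0ℚ + 0ℚ ≡ 0ℚ
    step = solve-∀ ℚ-ring

  -- `Cone (± T)` is the linear span of `T`, so Farkas' lemma also takes the place of Gaussian
  -- elimination.
  ±_ : List (Point n) → List (Point n)
  ± T = T ++ List.map ((- 1ℚ) ·_) T

  ⊥-± : ∀ {T} {w : Point n} → w ⊥ T → w ⊥ (± T)
  ⊥-± {T = T} {w} w⊥T v∈ with ∈-++⁻ T v∈
  ... | inj₁ v∈T = w⊥T v∈T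
  ... | inj₂ v∈-T with ∈-map⁻ ((- 1ℚ) ·_) v∈-T
  ...   | u , u∈T , refl = trans (dot--1 u w) (cong -_ (w⊥T u∈T))

  ±-⊥ : ∀ {T} {w : Point n} → (∀ {v} → v ∈ ± T → ⟨ v , w ⟩ ≤ 0ℚ) → w ⊥ T
  ±-⊥ {T = T} {w} ±T≤0 {v} v∈T = ℚ.≤-antisym (±T≤0 (∈-++⁺ˡ v∈T))
    (neg-≤0 (subst (_≤ 0ℚ) (dot--1 v w) (±T≤0 (∈-++⁺ʳ T (∈-map⁺ ((- 1ℚ) ·_) v∈T)))))

  first-failure : ∀ {a b} {A : Fin n → Set a} {B : Set b} → (∀ i → A i ⊎ B) → (∀ i → A i) ⊎ B
  first-failure {zero} A⊎B = inj₁ λ ()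
  first-failure {suc n} A⊎B with A⊎B zero | first-failure (A⊎B ∘ suc)
  ... | inj₂ b | _ = inj₂ b
  ... | inj₁ _ | inj₂ b = inj₂ b
  ... | inj₁ a | inj₁ as = inj₁ λ { zero → a ; (suc i) → as i }

  Spanning : List (Point n) → Set
  Spanning T = ∀ w → w ⊥ T → w ≡ 0ᵥ

  -- If every unit vector lies in the span of `T`, a vector orthogonal to `T` has all coordinates
  -- zero. Otherwise the functional separating a missing unit vector from the span is nonpositive on
  -- `± T`, hence orthogonal to `T`, and it is nonzero because it is positive on that unit vector.
  spanning⊎kernel : (T : List (Point n)) → Spanning T ⊎ ∃ λ w → w ⊥ T × w ≢ 0ᵥ
  spanning⊎kernel {n} T with first-failure unit∈span
    where
    unit∈span : (i : Fin n) → Cone (± T) (unit i) ⊎ ∃ λ w → w ⊥ T × w ≢ 0ᵥ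
    unit∈span i with farkas (± T) (unit i)
    ... | inj₁ unit∈ = inj₁ unit∈
    ... | inj₂ (w , ±T≤0 , 0<wᵢ) = inj₂ (w , ±-⊥ ±T≤0 , λ { refl → ℚ.<-irrefl (sym (dot-0ʳ (unit i))) 0<wᵢ })
  ... | inj₁ units∈ = inj₁ λ w w⊥T → ext λ i → begin
    lookup w i      ≡⟨ dot-unit w i ⟨
    ⟨ w , unit i ⟩  ≡⟨ dot-comm w (unit i) ⟩
    ⟨ unit i , w ⟩  ≡⟨ cone-⊥ (⊥-± w⊥T) (units∈ i) ⟩
    0ℚ              ≡⟨ lookup-0ᵥ i ⟨
    lookup 0ᵥ i     ∎
    where open ≡-Reasoning
  ... | inj₂ kernel = inj₂ kernel

  -1·≢0ᵥ : {x : Point n} → x ≢ 0ᵥ → (- 1ℚ) · x ≢ 0ᵥ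
  -1·≢0ᵥ {x = x} x≢0 -x≡0 = x≢0 (cancel x -x≡0)
    where
    step : ∀ a → - ((- 1ℚ) * a) ≡ a
    step = solve-∀ ℚ-ring
    cancel : ∀ {n} (x : Point n) → (- 1ℚ) · x ≡ 0ᵥ → x ≡ 0ᵥ
    cancel [] _ = refl
    cancel (a ∷ x) eq = cong₂ _∷_ (trans (sym (step a)) (cong -_ (Vec.∷-injectiveˡ eq))) (cancel x (Vec.∷-injectiveʳ eq))

  spanning⊎ascent : (T : List (Point n)) (u : Point n) →
    Spanning T ⊎ ∃ λ w → w ⊥ T × w ≢ 0ᵥ × 0ℚ ≤ ⟨ u , w ⟩
  spanning⊎ascent T u with spanning⊎kernel T
  ... | inj₁ spanning = inj₁ spanning
  ... | inj₂ (w , w⊥T , w≢0) with ℚ.≤-total 0ℚ ⟨ u , w ⟩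
  ...   | inj₁ 0≤uw = inj₂ (w , w⊥T , w≢0 , 0≤uw)
  ...   | inj₂ uw≤0 = inj₂ ((- 1ℚ) · w ,
          (λ {v} v∈T → trans (dot-·ʳ v (- 1ℚ) w) (cong ((- 1ℚ) *_) (w⊥T v∈T))) ,
          -1·≢0ᵥ w≢0 ,
          subst (0ℚ ≤_) (sym (trans (dot-comm u _) (trans (dot--1 w u) (cong -_ (dot-comm w u)))))
            (ℚ.neg-antimono-≤ uw≤0))

  -- Vertices of polyhedra

  Constraint : ℕ → Set
  Constraint n = Point n × ℚ

  Sat Tight : Point n → Constraint n → Set
  Sat d (c , β) = ⟨ c , d ⟩ ≤ β
  Tight d (c , β) = ⟨ c , d ⟩ ≡ β

  -- Triviality of the recession cone, which for a nonempty polyhedron amounts to boundedness.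
  Bounded : List (Constraint n) → Set
  Bounded C = ∀ w → (∀ {c β} → (c , β) ∈ C → ⟨ c , w ⟩ ≤ 0ℚ) → w ≡ 0ᵥ

  descend : ∀ {p q t β} → 0ℚ ≤ t → q ≤ 0ℚ → p ≤ β → p + t * q ≤ β
  descend {p} {β = β} 0≤t q≤0 p≤β =
    ℚ.≤-trans (ℚ.+-monoʳ-≤ p (*-nonpos 0≤t q≤0)) (subst (_≤ β) (sym (ℚ.+-identityʳ p)) p≤β)

  interpolate : ∀ {p q t t′ β} → 0ℚ ≤ t → t ≤ t′ → p ≤ β → p + t′ * q ≤ β → p + t * q ≤ β
  interpolate {p} {q} {t} {t′} {β} 0≤t t≤t′ p≤β p+t′q≤β with ℚ.≤-total q 0ℚ
  ... | inj₁ q≤0 = descend 0≤t q≤0 p≤β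
  ... | inj₂ 0≤q = ℚ.≤-trans (≤-offset (*-nonneg (≤⇒0≤- t≤t′) 0≤q) (step p q t t′)) p+t′q≤β
    where
    step : ∀ p q t t′ → p + t′ * q ≡ p + t * q + (t′ - t) * q
    step = solve-∀ ℚ-ring

  hitting-time : ∀ {p q β} → p ≤ β → 0ℚ < q → ∃ λ t → 0ℚ ≤ t × p + t * q ≡ β
  hitting-time {p} {q} {β} p≤β 0<q with reciprocal 0<q
  ... | r , 0<r , rq≡1 = (β - p) * r , *-nonneg (≤⇒0≤- p≤β) (ℚ.<⇒≤ 0<r) ,
    trans (step p q r β) (trans (cong (λ t → p + (β - p) * t) rq≡1) (step′ p β))
    where
    step : ∀ p q r β → p + (β - p) * r * q ≡ p + (β - p) * (r * q)
    step = solve-∀ ℚ-ring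
    step′ : ∀ p β → p + (β - p) * 1ℚ ≡ β
    step′ = solve-∀ ℚ-ring

  along : Point n → Point n → ℚ → Point n
  along d w t = d +ᵥ (t · w)

  -- `s` is the constraint that stops the ray from `d` along `w`, at time `t`. The permutation takes
  -- it out of `S`, so that the list still to be made tight becomes shorter.
  Blocked : Point n → Point n → List (Constraint n) → Set
  Blocked d w S = ∃ λ s → ∃₂ λ S′ t → S ↭ s ∷ S′ × 0ℚ ≤ t × Tight (along d w t) s × All (Sat (along d w t)) S′

  sat-along : ∀ {d w : Point n} {t} s → ⟨ proj₁ s , d ⟩ + t * ⟨ proj₁ s , w ⟩ ≤ proj₂ s → Sat (along d w t) s
  sat-along {d = d} {w} {t} (c , β) = subst (_≤ β) (sym (dot-ray c d t w))

  sat-descend : ∀ {d w : Point n} {t} s → 0ℚ ≤ t → ⟨ proj₁ s , w ⟩ ≤ 0ℚ → Sat d s → Sat (along d w t) s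
  sat-descend {d = d} {w} {t} s 0≤t s≤0 sat = sat-along {d = d} {w} {t} s (descend 0≤t s≤0 sat)

  sat-interpolate : ∀ {d w : Point n} {t t′} s → 0ℚ ≤ t → t ≤ t′ → Sat d s → Sat (along d w t′) s → Sat (along d w t) s
  sat-interpolate {d = d} {w} {t} {t′} s@(c , β) 0≤t t≤t′ sat sat′ =
    sat-along {d = d} {w} {t} s (interpolate 0≤t t≤t′ sat (subst (_≤ β) (dot-ray c d t′ w) sat′))

  hit : ∀ {d w : Point n} {S} s → Sat d s → 0ℚ < ⟨ proj₁ s , w ⟩ →
    (∀ {t} → 0ℚ ≤ t → Tight (along d w t) s → All (Sat (along d w t)) S) → Blocked d w (s ∷ S)
  hit {d = d} {w} {S} s@(c , β) sat 0<cw sats = s , S , t , ↭-refl , 0≤t , tight , sats 0≤t tight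
    where
    time = hitting-time sat 0<cw
    t = proj₁ time
    0≤t = proj₁ (proj₂ time)
    tight : ⟨ c , along d w t ⟩ ≡ β
    tight = trans (dot-ray c d t w) (proj₂ (proj₂ time))

  earlier : ∀ {d w : Point n} {t t′} s → 0ℚ < ⟨ proj₁ s , w ⟩ → Tight (along d w t) s → ¬ Sat (along d w t′) s → t ≤ t′
  earlier {d = d} {w} {t} {t′} (c , β) 0<cw tight ¬sat with ℚ.≤-total t t′
  ... | inj₁ t≤t′ = t≤t′
  ... | inj₂ t′≤t = contradiction
    (subst₂ _≤_ (sym (dot-ray c d t′ w)) (trans (sym (dot-ray c d t w)) tight)
      (ℚ.+-monoʳ-≤ ⟨ c , d ⟩ (ℚ.*-monoʳ-≤-nonNeg ⟨ c , w ⟩ {{nonNegative (ℚ.<⇒≤ 0<cw)}} t′≤t)))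
    ¬sat

  sat? : (d : Point n) (s : Constraint n) → Dec (Sat d s)
  sat? d (c , β) = ⟨ c , d ⟩ ℚ.≤? β

  -- The minimum-ratio rule of the simplex method. The blocker found so far is kept if the new
  -- constraint still holds at its time `t₁`. Otherwise the new constraint is reached no later than
  -- `t₁`, and all others, holding at time 0 and at `t₁`, hold in between by convexity.
  ratio-test : (d w : Point n) (S : List (Constraint n)) → All (Sat d) S →
    All (λ s → ⟨ proj₁ s , w ⟩ ≤ 0ℚ) S ⊎ Blocked d w S
  ratio-test d w [] [] = inj₁ []
  ratio-test d w (s ∷ S) (sat ∷ sats) with ratio-test d w S sats | 0ℚ ℚ.<? ⟨ proj₁ s , w ⟩
  ... | inj₁ S≤0 | no 0≮s = inj₁ (ℚ.≮⇒≥ 0≮s ∷ S≤0)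
  ... | inj₁ S≤0 | yes 0<s = inj₂ (hit s sat 0<s λ 0≤t _ →
          All.zipWith (λ {s} (s≤0 , sat) → sat-descend s 0≤t s≤0 sat) (S≤0 , sats))
  ... | inj₂ (s₁ , S₁ , t₁ , S↭ , 0≤t₁ , tight₁ , sats₁) | 0<?s with sat? (along d w t₁) s | 0<?s
  ...   | yes sat₁ | _ = inj₂ (s₁ , s ∷ S₁ , t₁ , ↭-trans (prep s S↭) (swap s s₁ ↭-refl) , 0≤t₁ , tight₁ , sat₁ ∷ sats₁)
  ...   | no ¬sat₁ | no 0≮s = contradiction (sat-descend s 0≤t₁ (ℚ.≮⇒≥ 0≮s) sat) ¬sat₁
  ...   | no ¬sat₁ | yes 0<s = inj₂ (hit s sat 0<s λ 0≤t tight →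
          All.zipWith (λ {s′} (sat , sat₁) → sat-interpolate s′ 0≤t (earlier {t′ = t₁} s 0<s tight ¬sat₁) sat sat₁)
            (sats , All-resp-↭ (↭-sym S↭) (ℚ.≤-reflexive tight₁ ∷ sats₁)))

  -- A basic feasible solution in the sense of linear programming.
  Basic : List (Constraint n) → Point n → Set
  Basic C d = All (Sat d) C × ∃ λ T → (∀ {c} → c ∈ T → c ∈ C) × All (Tight d) T × Spanning (List.map proj₁ T)

  -- Move from d along a direction w orthogonal to the tight constraints T and not decreasing u; the first slack
  -- constraint reached becomes tight, so the list S of the others shrinks.
  round : ∀ k {C : List (Constraint n)} (u : Point n) → Bounded C →
    ∀ T S → C ↭ T ++ S → length S ≡ k → ∀ d → All (Tight d) T → All (Sat d) S →
    ∃ λ d′ → Basic C d′ × ⟨ u , d ⟩ ≤ ⟨ u , d′ ⟩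
  round k {C} u bounded T S C↭ len d tight sat with spanning⊎ascent (List.map proj₁ T) u
  ... | inj₁ spanning = d , (All-resp-↭ (↭-sym C↭) (All.++⁺ (All.map ℚ.≤-reflexive tight) sat) ,
          T , (λ c∈T → ∈-resp-↭ (↭-sym C↭) (∈-++⁺ˡ c∈T)) , tight , spanning) , ℚ.≤-refl
  ... | inj₂ (w , w⊥T , w≢0 , 0≤uw) with ratio-test d w S sat
  -- An unblocked ray would make `w` a nonzero recession direction.
  ...   | inj₁ S≤0 = contradiction (bounded w C≤0) w≢0
    where
    C≤0 : ∀ {c β} → (c , β) ∈ C → ⟨ c , w ⟩ ≤ 0ℚ
    C≤0 c∈C with ∈-++⁻ T (∈-resp-↭ C↭ c∈C)
    ... | inj₁ c∈T = ℚ.≤-reflexive (w⊥T (∈-map⁺ proj₁ c∈T))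
    ... | inj₂ c∈S = All.lookup S≤0 c∈S
  round zero u bounded T S C↭ len d tight sat | inj₂ _ | inj₂ (s , S′ , t , S↭ , _) with trans (sym len) (↭-length S↭)
  ... | ()
  round (suc k) u bounded T S C↭ len d tight sat
    | inj₂ (w , w⊥T , w≢0 , 0≤uw) | inj₂ (s , S′ , t , S↭ , 0≤t , tight-s , sat′)
    with round k u bounded (s ∷ T) S′ (↭-trans C↭ (↭-trans (++⁺ˡ T S↭) (shift s T S′)))
           (ℕ.suc-injective (trans (sym (↭-length S↭)) len)) (along d w t) (tight-s ∷ still-tight) sat′
    where
    step : ∀ p t → p + t * 0ℚ ≡ p
    step = solve-∀ ℚ-ring
    still-tight : All (Tight (along d w t)) T
    still-tight = All.tabulate λ { {c , β} c∈T → trans (dot-ray c d t w)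
      (trans (cong (λ q → ⟨ c , d ⟩ + t * q) (w⊥T (∈-map⁺ proj₁ c∈T)))
        (trans (step ⟨ c , d ⟩ t) (All.lookup tight c∈T))) }
  ... | d′ , basic , u≤ = d′ , basic , ℚ.≤-trans (≤-offset (*-nonneg 0≤t 0≤uw) (dot-ray u d t w)) u≤

  basic-improvement : {C : List (Constraint n)} → Bounded C → ∀ u {d} → All (Sat d) C →
    ∃ λ d′ → Basic C d′ × ⟨ u , d ⟩ ≤ ⟨ u , d′ ⟩
  basic-improvement {C = C} bounded u {d} sat = round (length C) u bounded [] C ↭-refl refl d [] sat

  mid-tight : ∀ {p q t β} → p ≤ β → q ≤ β → 0ℚ < t → t < 1ℚ → t * p + (1ℚ - t) * q ≡ β → p ≡ β × q ≡ β
  mid-tight {p} {q} {t} {β} p≤β q≤β 0<t t<1 eq = ℚ.≤-antisym p≤β (ℚ.≮⇒≥ p≮β) , ℚ.≤-antisym q≤β (ℚ.≮⇒≥ q≮β)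
    where
    0<1-t = <⇒0<- t<1
    step : ∀ t β → t * β + (1ℚ - t) * β ≡ β
    step = solve-∀ ℚ-ring
    p≮β : ¬ p < β
    p≮β p<β = ℚ.<-irrefl (trans eq (sym (step t β))) (ℚ.+-mono-<-≤ (*-monoʳ-< 0<t p<β) (*-monoʳ-≤ (ℚ.<⇒≤ 0<1-t) q≤β))
    q≮β : ¬ q < β
    q≮β q<β = ℚ.<-irrefl (trans eq (sym (step t β))) (ℚ.+-mono-≤-< (*-monoʳ-≤ (ℚ.<⇒≤ 0<t) p≤β) (*-monoʳ-< 0<1-t q<β))

  difference-0 : (y z : Point n) → y +ᵥ ((- 1ℚ) · z) ≡ 0ᵥ → y ≡ z
  difference-0 [] [] _ = refl
  difference-0 (a ∷ y) (b ∷ z) eq = cong₂ _∷_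
    (trans (step a b) (trans (cong (_+ b) (Vec.∷-injectiveˡ eq)) (ℚ.+-identityˡ b)))
    (difference-0 y z (Vec.∷-injectiveʳ eq))
    where
    step : ∀ a b → a ≡ (a + (- 1ℚ) * b) + b
    step = solve-∀ ℚ-ring

  difference-⊥ : ∀ c {β} (y z : Point n) {t} → 0ℚ < t → t < 1ℚ → ⟨ c , y ⟩ ≤ β → ⟨ c , z ⟩ ≤ β →
    ⟨ c , (t · y) +ᵥ ((1ℚ - t) · z) ⟩ ≡ β → ⟨ c , y +ᵥ ((- 1ℚ) · z) ⟩ ≡ 0ℚ
  difference-⊥ c {β} y z {t} 0<t t<1 cy≤β cz≤β tight = trans (dot-ray c y (- 1ℚ) z)
    (trans (cong₂ (λ p q → p + (- 1ℚ) * q) (proj₁ both) (proj₂ both)) (step β))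
    where
    step : ∀ β → β + (- 1ℚ) * β ≡ 0ℚ
    step = solve-∀ ℚ-ring
    both : ⟨ c , y ⟩ ≡ β × ⟨ c , z ⟩ ≡ β
    both = mid-tight cy≤β cz≤β 0<t t<1
      (trans (sym (trans (dot-ray c (t · y) (1ℚ - t) z) (cong (_+ (1ℚ - t) * ⟨ c , z ⟩) (dot-·ʳ c t y)))) tight)

  -- A constraint tight at a point strictly between `y` and `z` is tight at both ends, so y - z is
  -- orthogonal to the tight normals. These span, hence y = z.
  basic⇒vertex : ∀ {S : PSet n} {C d} → (∀ {x} → S x → All (Sat x) C) → (∀ {x} → All (Sat x) C → S x) →
    Basic C d → IsVertex S d
  basic⇒vertex {S = S} {C} {d} S⊆ ⊆S (sat , T , T⊆C , tight , spanning) = ⊆S sat , extreme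
    where
    extreme : ∀ y z t → S y → S z → 0ℚ < t → t < 1ℚ → d ≡ (t · y) +ᵥ ((1ℚ - t) · z) → y ≡ z
    extreme y z t y∈ z∈ 0<t t<1 refl = difference-0 y z (spanning _ y-z⊥T)
      where
      y-z⊥T : (y +ᵥ ((- 1ℚ) · z)) ⊥ List.map proj₁ T
      y-z⊥T v∈ with ∈-map⁻ proj₁ v∈
      ... | (c , β) , c∈T , refl = difference-⊥ c y z 0<t t<1
        (All.lookup (S⊆ y∈) (T⊆C c∈T)) (All.lookup (S⊆ z∈) (T⊆C c∈T)) (All.lookup tight c∈T)

  -- Integers inside ℚ

  ι : ℤ → ℚ
  ι z = z / 1

  -- `z / 1` is normalized through a gcd and does not reduce for a variable `z`. The explicit
  -- fraction does, so sums, products and comparisons are computed through it.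
  ι≡mkℚ : ∀ z → ι z ≡ mkℚ z 0 (Coprime.sym (Coprime.1-coprimeTo ℤ.∣ z ∣))
  ι≡mkℚ z = ℚ.↥p/↧p≡p (mkℚ z 0 (Coprime.sym (Coprime.1-coprimeTo ℤ.∣ z ∣)))

  ι-+ : ∀ x y → ι (x ℤ.+ y) ≡ ι x + ι y
  ι-+ x y = sym (trans (cong₂ _+_ (ι≡mkℚ x) (ι≡mkℚ y)) (cong ι (cong₂ ℤ._+_ (ℤ.*-identityʳ x) (ℤ.*-identityʳ y))))

  ι-* : ∀ x y → ι (x ℤ.* y) ≡ ι x * ι y
  ι-* x y = sym (cong₂ _*_ (ι≡mkℚ x) (ι≡mkℚ y))

  ι-mono-≤ : ∀ {x y} → x ℤ.≤ y → ι x ≤ ι y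
  ι-mono-≤ {x} {y} x≤y = subst₂ _≤_ (sym (ι≡mkℚ x)) (sym (ι≡mkℚ y)) (*≤* (ℤ.*-monoʳ-≤-nonNeg 1ℤ x≤y))

  ι-cancel-≤ : ∀ {x y} → ι x ≤ ι y → x ℤ.≤ y
  ι-cancel-≤ {x} {y} x≤y with subst₂ _≤_ (ι≡mkℚ x) (ι≡mkℚ y) x≤y
  ... | *≤* x≤y′ = subst₂ ℤ._≤_ (ℤ.*-identityʳ x) (ℤ.*-identityʳ y) x≤y′

  ι-cancel-< : ∀ {x y} → ι x < ι y → x ℤ.< y
  ι-cancel-< ιx<ιy = ℤ.≰⇒> λ y≤x → ℚ.<-irrefl refl (ℚ.<-≤-trans ιx<ιy (ι-mono-≤ y≤x))

  ι-injective : ∀ {x y} → ι x ≡ ι y → x ≡ y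
  ι-injective ιx≡ιy = ℤ.≤-antisym (ι-cancel-≤ (ℚ.≤-reflexive ιx≡ιy)) (ι-cancel-≤ (ℚ.≤-reflexive (sym ιx≡ιy)))

  dot-integral : (x y : Vec ℤ n) → ∃ λ k → ⟨ toℚᵥ x , toℚᵥ y ⟩ ≡ ι k
  dot-integral [] [] = 0ℤ , refl
  dot-integral (x ∷ xs) (y ∷ ys) with dot-integral xs ys
  ... | k , eq = x ℤ.* y ℤ.+ k , trans (cong₂ _+_ (sym (ι-* x y)) eq) (sym (ι-+ (x ℤ.* y) k))

  -- Affine hulls and full dimension

  dot-nonneg : (u v : Point n) → NonNeg u → NonNeg v → 0ℚ ≤ ⟨ u , v ⟩
  dot-nonneg [] [] _ _ = ℚ.≤-refl
  dot-nonneg (a ∷ u) (b ∷ v) 0≤u 0≤v = +-nonneg (*-nonneg (0≤u zero) (0≤v zero)) (dot-nonneg u v (0≤u ∘ suc) (0≤v ∘ suc))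

  combine-⊥ : (w : Point n) (cs : List (ℚ × Point n)) → All (λ cp → ⟨ w , proj₂ cp ⟩ ≡ 0ℚ) cs → ⟨ w , combine cs ⟩ ≡ 0ℚ
  combine-⊥ w [] [] = dot-0ʳ w
  combine-⊥ w ((c , p) ∷ cs) (wp≡0 ∷ all) = trans (dot-+ʳ w (c · p) (combine cs))
    (cong₂ _+_ (trans (dot-·ʳ w c p) (trans (cong (c *_) wp≡0) (ℚ.*-zeroʳ c))) (combine-⊥ w cs all))

  aff-⊥ : ∀ {S : PSet n} {w} → (∀ {p} → S p → ⟨ w , p ⟩ ≡ 0ℚ) → ∀ {x} → Aff S x → ⟨ w , x ⟩ ≡ 0ℚ
  aff-⊥ {w = w} S⊥ (cs , all , _ , refl) = combine-⊥ w cs (All.map S⊥ all)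

  aff-nonempty : ∀ {S : PSet n} {x} → Aff S x → ∃ S
  aff-nonempty ([] , _ , () , _)
  aff-nonempty ((_ , p) ∷ _ , p∈S ∷ _ , _) = p , p∈S

  module _ {n} {P : Polytope n} (full : FullDimensional P) (anti : AntiBlocking P) where

    private
      nonneg = proj₁ anti
      down = proj₂ anti

    -- Affine coefficients sum to 1, so they cannot be the empty list: `P` contains a point, and 0
    -- lies below it.
    0∈P : ⟦ P ⟧ 0ᵥ
    0∈P with aff-nonempty (full 0ᵥ)
    ... | p , p∈P = down 0ᵥ p p∈P (λ i → ℚ.≤-reflexive (sym (lookup-0ᵥ i)))
            (λ i → subst (_≤ lookup p i) (sym (lookup-0ᵥ i)) (nonneg p p∈P i))

    -- Both `w` and `P` are nonnegative, so ⟨w,·⟩ vanishes on `P` and therefore on its affine hull.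
    -- That hull is the whole space and contains `w` itself, whence ⟨w,w⟩ = 0.
    nonpos-on-P⇒0 : ∀ {w} → NonNeg w → (∀ {v} → v ∈ P → ⟨ w , v ⟩ ≤ 0ℚ) → w ≡ 0ᵥ
    nonpos-on-P⇒0 {w} 0≤w P≤0 with 0ᵥ⊎dot-self-pos w
    ... | inj₁ w≡0 = w≡0
    ... | inj₂ 0<w = contradiction 0<w (ℚ.<-irrefl (sym (aff-⊥ {w = w} P⊥ (full w))))
      where
      P⊥ : ∀ {p} → ⟦ P ⟧ p → ⟨ w , p ⟩ ≡ 0ℚ
      P⊥ {p} p∈P = ℚ.≤-antisym (conv-dot {w = w} P≤0 p∈P) (dot-nonneg w p 0≤w (nonneg p p∈P))

  -- The anti-blocking dual

  -- A functional bounded by 1 on the generators is bounded by 1 on their hull, so A(P) is a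
  -- polyhedron with finitely many constraints and the vertex search applies to it.
  dualConstraints : Polytope n → List (Constraint n)
  dualConstraints {n} P = List.map (λ i → (- 1ℚ) · unit i , 0ℚ) (allFin n) ++ List.map (_, 1ℚ) P

  module _ {n} {P : Polytope n} where

    dot-neg-unit : ∀ i (d : Point n) → ⟨ (- 1ℚ) · unit i , d ⟩ ≡ - lookup d i
    dot-neg-unit i d = trans (dot--1 (unit i) d) (cong -_ (trans (dot-comm (unit i) d) (dot-unit d i)))

    dual⇒sat : ∀ {d} → ABDual ⟦ P ⟧ d → All (Sat d) (dualConstraints P)
    dual⇒sat {d} (0≤d , d≤1) = All.++⁺
      (All.map⁺ (All.tabulate λ {i} _ → subst (_≤ 0ℚ) (sym (dot-neg-unit i d)) (ℚ.neg-antimono-≤ (0≤d i))))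
      (All.map⁺ (All.tabulate λ {v} v∈P → subst (_≤ 1ℚ) (dot-comm d v) (d≤1 v (vertex∈conv v∈P))))

    sat⇒dual : ∀ {d} → All (Sat d) (dualConstraints P) → ABDual ⟦ P ⟧ d
    sat⇒dual {d} sat =
      (λ i → neg-≤0 (subst (_≤ 0ℚ) (dot-neg-unit i d) (All.lookup sat (∈-++⁺ˡ (∈-map⁺ _ (∈-allFin i)))))) ,
      (λ x → conv-dot {w = d} λ {v} v∈P → subst (_≤ 1ℚ) (dot-comm v d) (All.lookup sat (∈-++⁺ʳ _ (∈-map⁺ (_, 1ℚ) v∈P))))

    -- A recession direction of A(P) is nonnegative, yet nonpositive on `P`; full dimension makes it
    -- zero.
    dual-bounded : FullDimensional P → AntiBlocking P → Bounded (dualConstraints P)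
    dual-bounded full anti w constraints≤0 = nonpos-on-P⇒0 full anti
      (λ i → neg-≤0 (subst (_≤ 0ℚ) (dot-neg-unit i w) (constraints≤0 (∈-++⁺ˡ (∈-map⁺ _ (∈-allFin i))))))
      (λ {v} v∈P → subst (_≤ 0ℚ) (dot-comm v w) (constraints≤0 (∈-++⁺ʳ _ (∈-map⁺ (_, 1ℚ) v∈P))))

    dual-vertex : FullDimensional P → AntiBlocking P → ∀ u {d} → ABDual ⟦ P ⟧ d →
      ∃ λ d′ → IsVertex (ABDual ⟦ P ⟧) d′ × ⟨ u , d ⟩ ≤ ⟨ u , d′ ⟩
    dual-vertex full anti u d∈ = proj₁ improved ,
      basic⇒vertex {S = ABDual ⟦ P ⟧} dual⇒sat sat⇒dual (proj₁ (proj₂ improved)) , proj₂ (proj₂ improved)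
      where
      improved = basic-improvement (dual-bounded full anti) u (dual⇒sat d∈)

  -- A separating functional w is replaced by its positive part w⁺ = clip w w: ⟨w⁺,x⟩ = ⟨w, clip w x⟩,
  -- and clipping preserves an anti-blocking polytope.
  clip : ℚ → ℚ → ℚ
  clip w x with 0ℚ ℚ.<? w
  ... | yes _ = x
  ... | no _ = 0ℚ

  clip-nonneg : ∀ w {x} → 0ℚ ≤ x → 0ℚ ≤ clip w x
  clip-nonneg w 0≤x with 0ℚ ℚ.<? w
  ... | yes _ = 0≤x
  ... | no _ = ℚ.≤-refl

  clip-≤ : ∀ w {x} → 0ℚ ≤ x → clip w x ≤ x
  clip-≤ w 0≤x with 0ℚ ℚ.<? w
  ... | yes _ = ℚ.≤-refl
  ... | no _ = 0≤x

  clip-self-nonneg : ∀ w → 0ℚ ≤ clip w w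
  clip-self-nonneg w with 0ℚ ℚ.<? w
  ... | yes 0<w = ℚ.<⇒≤ 0<w
  ... | no _ = ℚ.≤-refl

  clip-self-* : ∀ w x → clip w w * x ≡ w * clip w x
  clip-self-* w x with 0ℚ ℚ.<? w
  ... | yes _ = refl
  ... | no _ = trans (ℚ.*-zeroˡ x) (sym (ℚ.*-zeroʳ w))

  clip-self-≥ : ∀ w → w ≤ clip w w
  clip-self-≥ w with 0ℚ ℚ.<? w
  ... | yes _ = ℚ.≤-refl
  ... | no 0≮w = ℚ.≮⇒≥ 0≮w

  clipᵥ : Point n → Point n → Point n
  clipᵥ = Vec.zipWith clip

  clipᵥ-self-dot : (w x : Point n) → ⟨ clipᵥ w w , x ⟩ ≡ ⟨ w , clipᵥ w x ⟩
  clipᵥ-self-dot [] [] = refl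
  clipᵥ-self-dot (a ∷ w) (b ∷ x) = cong₂ _+_ (clip-self-* a b) (clipᵥ-self-dot w x)

  dot-monoˡ-≤ : {u v x : Point n} → u ≤ᵥ v → NonNeg x → ⟨ u , x ⟩ ≤ ⟨ v , x ⟩
  dot-monoˡ-≤ {u = []} {[]} {[]} _ _ = ℚ.≤-refl
  dot-monoˡ-≤ {u = a ∷ u} {b ∷ v} {c ∷ x} u≤v 0≤x = ℚ.+-mono-≤
    (subst₂ _≤_ (ℚ.*-comm c a) (ℚ.*-comm c b) (*-monoʳ-≤ (0≤x zero) (u≤v zero)))
    (dot-monoˡ-≤ {u = u} {v} {x} (u≤v ∘ suc) (0≤x ∘ suc))

  module _ {n} {P : Polytope n} (full : FullDimensional P) (anti : AntiBlocking P) where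

    private
      nonneg = proj₁ anti
      down = proj₂ anti

    clip∈P : ∀ w {x} → ⟦ P ⟧ x → ⟦ P ⟧ (clipᵥ w x)
    clip∈P w {x} x∈P = down _ x x∈P
      (λ i → subst (0ℚ ≤_) (sym (Vec.lookup-zipWith clip i w x)) (clip-nonneg (lookup w i) (nonneg x x∈P i)))
      (λ i → subst (_≤ lookup x i) (sym (Vec.lookup-zipWith clip i w x)) (clip-≤ (lookup w i) (nonneg x x∈P i)))

    -- Dividing w⁺ by `β` puts it in A(P). Here `β` is nonnegative because 0 lies in `P`, and it
    -- cannot be 0: w⁺ would then vanish, although its value at `y` exceeds `β`.
    dual-separation : ∀ {y} → NonNeg y → ¬ ⟦ P ⟧ y → ∃ λ d → ABDual ⟦ P ⟧ d × 1ℚ < ⟨ d , y ⟩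
    dual-separation {y} 0≤y y∉P with conv⊎separated P y
    ... | inj₁ y∈P = contradiction y∈P y∉P
    ... | inj₂ (w , β , P≤β , β<y) = separate (0ℚ ℚ.<? β)
      where
      w⁺ = clipᵥ w w

      0≤w⁺ : NonNeg w⁺
      0≤w⁺ i = subst (0ℚ ≤_) (sym (Vec.lookup-zipWith clip i w w)) (clip-self-nonneg (lookup w i))

      w⁺≤β : ∀ {x} → ⟦ P ⟧ x → ⟨ w⁺ , x ⟩ ≤ β
      w⁺≤β {x} x∈P = subst (_≤ β) (sym (clipᵥ-self-dot w x)) (conv-dot {w = w} P≤β (clip∈P w x∈P))

      β<w⁺y : β < ⟨ w⁺ , y ⟩
      β<w⁺y = ℚ.<-≤-trans β<y (dot-monoˡ-≤ {u = w} {w⁺} {y}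
        (λ i → subst (lookup w i ≤_) (sym (Vec.lookup-zipWith clip i w w)) (clip-self-≥ (lookup w i))) 0≤y)

      0≤β : 0ℚ ≤ β
      0≤β = subst (_≤ β) (dot-0ʳ w⁺) (w⁺≤β (0∈P full anti))

      separate : Dec (0ℚ < β) → ∃ λ d → ABDual ⟦ P ⟧ d × 1ℚ < ⟨ d , y ⟩
      separate (yes 0<β) with reciprocal 0<β
      ... | r , 0<r , rβ≡1 = r · w⁺ ,
        ((λ i → subst (0ℚ ≤_) (sym (Vec.lookup-map i (r *_) w⁺)) (*-nonneg (ℚ.<⇒≤ 0<r) (0≤w⁺ i))) ,
         (λ x x∈P → subst₂ _≤_ (sym (·-dot r w⁺ x)) rβ≡1 (*-monoʳ-≤ (ℚ.<⇒≤ 0<r) (w⁺≤β x∈P)))) ,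
        subst₂ _<_ rβ≡1 (sym (·-dot r w⁺ y)) (*-monoʳ-< 0<r β<w⁺y)
      separate (no 0≮β) = contradiction (ℚ.≤-<-trans 0≤β β<w⁺y) (ℚ.<-irrefl (sym w⁺y≡0))
        where
        w⁺≡0 : w⁺ ≡ 0ᵥ
        w⁺≡0 = nonpos-on-P⇒0 full anti 0≤w⁺ λ v∈P → ℚ.≤-trans (w⁺≤β (vertex∈conv v∈P)) (ℚ.≮⇒≥ 0≮β)
        w⁺y≡0 : ⟨ w⁺ , y ⟩ ≡ 0ℚ
        w⁺y≡0 = trans (cong (⟨_, y ⟩) w⁺≡0) (trans (dot-comm 0ᵥ y) (dot-0ʳ y))

    -- With r = 1/k the conclusion places `z` in the dilate by `k`, starting from the dilate by k +
    -- 1. An integral vertex of A(P) takes an integer value at `z`, which cannot lie strictly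
    -- between `k` and k + 1; and `c`, being positive, excludes k + 1 and everything above.
    integral-gap : DualIntegral P → ∀ k {r c} → 0ℚ < r → r * ℕtoℚ k ≡ 1ℚ → 0ℚ < c → ∀ z → NonNeg (toℚᵥ z) →
      Scale (ℕtoℚ (k ℕ.+ 1)) ⟦ P ⟧ (toℚᵥ z +ᵥ (c · toℚᵥ z)) → ⟦ P ⟧ (r · toℚᵥ z)
    integral-gap integral k {r} {c} 0<r rk≡1 0<c z 0≤z (q , q∈P , eq) = decidable-stable (conv? P (r · x)) refute
      where
      x = toℚᵥ z
      0≤rx : NonNeg (r · x)
      0≤rx i = subst (0ℚ ≤_) (sym (Vec.lookup-map i (r *_) x)) (*-nonneg (ℚ.<⇒≤ 0<r) (0≤z i))

      lattice-dual⇒≯1 : ∀ m → (∀ p → ⟦ P ⟧ p → ⟨ toℚᵥ m , p ⟩ ≤ 1ℚ) → ¬ 1ℚ < ⟨ r · x , toℚᵥ m ⟩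
      lattice-dual⇒≯1 m m≤1 1<m = ℚ.<-irrefl refl (ℚ.<-≤-trans D<D+cD (ℚ.≤-trans D+cD≤k+1 k+1≤D))
        where
        D = proj₁ (dot-integral m z)
        mz≡D = proj₂ (dot-integral m z)

        1<rD : 1ℚ < r * ι D
        1<rD = subst (1ℚ <_) (trans (·-dot r x (toℚᵥ m)) (cong (r *_) (trans (dot-comm x (toℚᵥ m)) mz≡D))) 1<m

        k<D : ℕtoℚ k < ι D
        k<D = ℚ.≰⇒> λ D≤k → ℚ.<-irrefl refl (ℚ.<-≤-trans 1<rD (subst (r * ι D ≤_) rk≡1 (*-monoʳ-≤ (ℚ.<⇒≤ 0<r) D≤k)))

        k+1≤D : ℕtoℚ (k ℕ.+ 1) ≤ ι D
        k+1≤D = ι-mono-≤ {y = D} (subst (λ l → ℤ.+ l ℤ.≤ D) (ℕ.+-comm 1 k) (ℤ.i<j⇒suc[i]≤j (ι-cancel-< {ℤ.+ k} {D} k<D)))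

        0<D : 0ℚ < ι D
        0<D = ℚ.≤-<-trans (ι-mono-≤ {0ℤ} {ℤ.+ k} (ℤ.+≤+ ℕ.z≤n)) k<D

        D+cD≤k+1 : ι D + c * ι D ≤ ℕtoℚ (k ℕ.+ 1)
        D+cD≤k+1 = subst₂ _≤_
          (trans (sym (dot-·ʳ (toℚᵥ m) (ℕtoℚ (k ℕ.+ 1)) q)) (trans (cong ⟨ toℚᵥ m ,_⟩ (sym eq))
            (trans (dot-ray (toℚᵥ m) x c x) (cong (λ t → t + c * t) mz≡D))))
          (ℚ.*-identityʳ _)
          (*-monoʳ-≤ (ι-mono-≤ {0ℤ} {ℤ.+ (k ℕ.+ 1)} (ℤ.+≤+ ℕ.z≤n)) (m≤1 q q∈P))

        D<D+cD : ι D < ι D + c * ι D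
        D<D+cD = <-offset (*-pos 0<c 0<D) refl

      integral⇒≯1 : ∀ {d} → IsIntegral d → (∀ p → ⟦ P ⟧ p → ⟨ d , p ⟩ ≤ 1ℚ) → ¬ 1ℚ < ⟨ r · x , d ⟩
      integral⇒≯1 (m , refl) = lattice-dual⇒≯1 m

      refute : ¬ ¬ ⟦ P ⟧ (r · x)
      refute rx∉P = integral⇒≯1 (integral d′ vertex) (proj₂ (proj₁ vertex)) 1<d′
        where
        separation = dual-separation 0≤rx rx∉P
        d = proj₁ separation
        -- The separating `d` need not be integral. Passing to a vertex does not lower the value at
        -- `r · x`, so the separation survives.
        improved = dual-vertex full anti (r · x) (proj₁ (proj₂ separation))
        d′ = proj₁ improved
        vertex = proj₁ (proj₂ improved)
        1<d′ : 1ℚ < ⟨ r · x , d′ ⟩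
        1<d′ = ℚ.<-≤-trans (subst (1ℚ <_) (dot-comm d (r · x)) (proj₂ (proj₂ separation))) (proj₂ (proj₂ improved))

  -- Relative interiors

  ≤∣∣ : ∀ p → p ≤ ∣ p ∣
  ≤∣∣ p with ℚ.≤-total 0ℚ p
  ... | inj₁ 0≤p = ℚ.≤-reflexive (sym (ℚ.0≤p⇒∣p∣≡p 0≤p))
  ... | inj₂ p≤0 = ℚ.≤-trans p≤0 (ℚ.0≤∣p∣ p)

  -≤∣∣ : ∀ p → - p ≤ ∣ p ∣
  -≤∣∣ p = subst (- p ≤_) (ℚ.∣-p∣≡∣p∣ p) (≤∣∣ (- p))

  ‖_‖₁ : Point n → ℚ
  ‖ [] ‖₁ = 0ℚ
  ‖ x ∷ xs ‖₁ = ∣ x ∣ + ‖ xs ‖₁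

  ‖‖₁-nonneg : (x : Point n) → 0ℚ ≤ ‖ x ‖₁
  ‖‖₁-nonneg [] = ℚ.≤-refl
  ‖‖₁-nonneg (x ∷ xs) = +-nonneg (ℚ.0≤∣p∣ x) (‖‖₁-nonneg xs)

  ∣lookup∣≤‖‖₁ : (x : Point n) (i : Fin n) → ∣ lookup x i ∣ ≤ ‖ x ‖₁
  ∣lookup∣≤‖‖₁ (x ∷ xs) zero = ≤-offset (‖‖₁-nonneg xs) refl
  ∣lookup∣≤‖‖₁ (x ∷ xs) (suc i) = ℚ.≤-trans (∣lookup∣≤‖‖₁ xs i) (≤-offset (ℚ.0≤∣p∣ x) (ℚ.+-comm ∣ x ∣ ‖ xs ‖₁))

  -- The witness is ε / (1 + ‖s‖₁). The added 1 keeps the denominator positive when `s` is zero and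
  -- makes the inequality strict.
  small-multiple : (s : Point n) {ε : ℚ} → 0ℚ < ε → ∃ λ c → 0ℚ < c × ∀ i → c * ∣ lookup s i ∣ < ε
  small-multiple s {ε} 0<ε = ε * r , 0<c , λ i → subst (ε * r * ∣ lookup s i ∣ <_) c*‖s‖≡ε
      (*-monoʳ-< 0<c (ℚ.≤-<-trans (∣lookup∣≤‖‖₁ s i) (<-offset {e = 1ℚ} (ℚ.positive⁻¹ 1ℚ) (ℚ.+-comm 1ℚ ‖ s ‖₁))))
    where
    0<1+‖s‖ : 0ℚ < 1ℚ + ‖ s ‖₁
    0<1+‖s‖ = ℚ.+-mono-<-≤ (ℚ.positive⁻¹ 1ℚ) (‖‖₁-nonneg s)
    r = proj₁ (reciprocal 0<1+‖s‖)
    0<c : 0ℚ < ε * r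
    0<c = *-pos 0<ε (proj₁ (proj₂ (reciprocal 0<1+‖s‖)))
    c*‖s‖≡ε : ε * r * (1ℚ + ‖ s ‖₁) ≡ ε
    c*‖s‖≡ε = trans (ℚ.*-assoc ε r _) (trans (cong (ε *_) (proj₂ (proj₂ (reciprocal 0<1+‖s‖)))) (ℚ.*-identityʳ ε))

  lookup-ray : (x : Point n) (c : ℚ) (y : Point n) (i : Fin n) → lookup (x +ᵥ (c · y)) i ≡ lookup x i + c * lookup y i
  lookup-ray x c y i = trans (Vec.lookup-zipWith _+_ i x (c · y)) (cong (lookup x i +_) (Vec.lookup-map i (c *_) y))

  -- Weight `- e` on the origin restores the coefficient sum to 1, whatever the sign of `e`.
  aff-ray : ∀ {S : PSet n} {x s} e → S 0ᵥ → S x → S s → Aff S (x +ᵥ (e · s))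
  aff-ray {n} {S} {x} {s} e 0∈ x∈ s∈ =
    (1ℚ , x) ∷ (e , s) ∷ (- e , 0ᵥ) ∷ [] , x∈ ∷ s∈ ∷ 0∈ ∷ [] , sum e , combination x s
    where
    sum : ∀ e → 1ℚ + (e + (- e + 0ℚ)) ≡ 1ℚ
    sum = solve-∀ ℚ-ring
    step : ∀ e x s → x + e * s ≡ 1ℚ * x + (e * s + (- e * 0ℚ + 0ℚ))
    step = solve-∀ ℚ-ring
    combination : ∀ {n} (x s : Point n) → x +ᵥ (e · s) ≡ (1ℚ · x) +ᵥ ((e · s) +ᵥ (((- e) · 0ᵥ) +ᵥ 0ᵥ))
    combination [] [] = refl
    combination (x ∷ xs) (s ∷ ss) = cong₂ _∷_ (step e x s) (combination xs ss)

  -- Both directions are used: forward to enlarge a lattice point, backward to show that its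
  -- coordinates on `J` are positive.
  relint-move : ∀ {S : PSet n} {x s} → RelInt S x → S 0ᵥ → S s →
    ∃ λ c → 0ℚ < c × S (x +ᵥ (c · s)) × S (x +ᵥ ((- c) · s))
  relint-move {S = S} {x} {s} (x∈ , ε , 0<ε , near) 0∈ s∈ = c , 0<c ,
    near _ (aff-ray {S = S} c 0∈ x∈ s∈) (λ i → subst (_< ε) (sym (distance c i (∣c*∣ i))) (close i)) ,
    near _ (aff-ray {S = S} (- c) 0∈ x∈ s∈) (λ i → subst (_< ε) (sym (distance (- c) i (∣-c*∣ i))) (close i))
    where
    c = proj₁ (small-multiple s 0<ε)
    0<c = proj₁ (proj₂ (small-multiple s 0<ε))
    close = proj₂ (proj₂ (small-multiple s 0<ε))
    ∣c*∣ : ∀ i → ∣ c * lookup s i ∣ ≡ c * ∣ lookup s i ∣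
    ∣c*∣ i = trans (ℚ.∣p*q∣≡∣p∣*∣q∣ c (lookup s i)) (cong (_* ∣ lookup s i ∣) (ℚ.0≤p⇒∣p∣≡p (ℚ.<⇒≤ 0<c)))
    ∣-c*∣ : ∀ i → ∣ - c * lookup s i ∣ ≡ c * ∣ lookup s i ∣
    ∣-c*∣ i = trans (cong ∣_∣ (sym (ℚ.neg-distribˡ-* c (lookup s i)))) (trans (ℚ.∣-p∣≡∣p∣ _) (∣c*∣ i))
    step : ∀ x y → x - (x + y) ≡ - y
    step = solve-∀ ℚ-ring
    distance : ∀ e i → ∣ e * lookup s i ∣ ≡ c * ∣ lookup s i ∣ →
      ∣ lookup x i - lookup (x +ᵥ (e · s)) i ∣ ≡ c * ∣ lookup s i ∣
    distance e i eq = trans (cong (λ t → ∣ lookup x i - t ∣) (lookup-ray x e s i))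
      (trans (cong ∣_∣ (step (lookup x i) (e * lookup s i))) (trans (ℚ.∣-p∣≡∣p∣ _) eq))

  -- As first argument of `clipᵥ` it gives the coordinate projection onto the face of `J`, so
  -- `clip∈P` shows that this projection preserves `P`.
  indicator : Vec Bool n → Point n
  indicator = Vec.map (if_then 1ℚ else 0ℚ)

  clip-in : ∀ (J : Vec Bool n) p i → lookup J i ≡ true → lookup (clipᵥ (indicator J) p) i ≡ lookup p i
  clip-in J p i i∈J = trans (Vec.lookup-zipWith clip i (indicator J) p)
    (cong (λ t → clip t (lookup p i)) (trans (Vec.lookup-map i _ J) (cong (if_then 1ℚ else 0ℚ) i∈J)))

  clip-out : ∀ (J : Vec Bool n) p i → lookup J i ≡ false → lookup (clipᵥ (indicator J) p) i ≡ 0ℚ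
  clip-out J p i i∉J = trans (Vec.lookup-zipWith clip i (indicator J) p)
    (cong (λ t → clip t (lookup p i)) (trans (Vec.lookup-map i _ J) (cong (if_then 1ℚ else 0ℚ) i∉J)))

  ·-cancel : ∀ r k → r * k ≡ 1ℚ → (x : Point n) → x ≡ k · (r · x)
  ·-cancel r k rk≡1 [] = refl
  ·-cancel r k rk≡1 (x ∷ xs) = cong₂ _∷_
    (trans (sym (ℚ.*-identityˡ x)) (trans (cong (_* x) (trans (sym rk≡1) (ℚ.*-comm r k))) (ℚ.*-assoc k r x)))
    (·-cancel r k rk≡1 xs)

  scale-nonneg : ∀ {k} {S : PSet n} → 0ℚ ≤ k → (∀ x → S x → NonNeg x) → ∀ {x} → Scale k S x → NonNeg x
  scale-nonneg {k = k} 0≤k S≥0 (y , y∈S , refl) i =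
    subst (0ℚ ≤_) (sym (Vec.lookup-map i (k *_) y)) (*-nonneg 0≤k (S≥0 y y∈S i))

  unscale : ∀ {r k} → r * k ≡ 1ℚ → ∀ {S : PSet n} {x} → Scale k S x → S (r · x)
  unscale {r = r} {k} rk≡1 {S} (y , y∈S , refl) = subst S (·-cancel k r (trans (ℚ.*-comm k r) rk≡1) y) y∈S

  lookup-toℚᵥ : (z : Vec ℤ n) (i : Fin n) → lookup (toℚᵥ z) i ≡ ι (lookup z i)
  lookup-toℚᵥ z i = Vec.lookup-map i ι z

  Positive-on : Vec Bool n → Vec ℤ n → Set
  Positive-on J z = ∀ i → lookup J i ≡ true → 1ℤ ℤ.≤ lookup z i

  Zero-off : Vec Bool n → Vec ℤ n → Set
  Zero-off J z = ∀ i → lookup J i ≡ false → lookup z i ≡ 0ℤ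

  module _ {n} {P : Polytope n} (full : FullDimensional P) (anti : AntiBlocking P) (integral : DualIntegral P)
    (k : ℕ) (r : ℚ) (0<r : 0ℚ < r) (rk≡1 : r * ℕtoℚ k ≡ 1ℚ) (J : Vec Bool n) where

    private
      nonneg = proj₁ anti
      down = proj₂ anti
      K = ℕtoℚ (k ℕ.+ 1)
      S = Scale K (Restrict ⟦ P ⟧ J)

      0≤k : 0ℚ ≤ ℕtoℚ k
      0≤k = ι-mono-≤ {0ℤ} {ℤ.+ k} (ℤ.+≤+ ℕ.z≤n)

      0<k : 0ℚ < ℕtoℚ k
      0<k with ℚ.<-cmp 0ℚ (ℕtoℚ k)
      ... | tri< 0<k _ _ = 0<k
      ... | tri≈ _ 0≡k _ = contradiction (trans (sym rk≡1) (trans (cong (r *_) (sym 0≡k)) (ℚ.*-zeroʳ r))) λ ()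
      ... | tri> _ _ k<0 = contradiction (ℚ.<-≤-trans k<0 0≤k) (ℚ.<-irrefl refl)

      1≤k : 1ℚ ≤ ℕtoℚ k
      1≤k = ι-mono-≤ {1ℤ} (ℤ.i<j⇒suc[i]≤j (ι-cancel-< {0ℤ} {ℤ.+ k} 0<k))

      K≡k+1 : K ≡ ℕtoℚ k + 1ℚ
      K≡k+1 = ι-+ (ℤ.+ k) (1ℤ)

      k<K : ℕtoℚ k < K
      k<K = <-offset (ℚ.positive⁻¹ 1ℚ) K≡k+1

      0<K : 0ℚ < K
      0<K = ℚ.≤-<-trans 0≤k k<K

      S-nonneg : ∀ {x} → S x → NonNeg x
      S-nonneg = scale-nonneg (ℚ.<⇒≤ 0<K) (λ x x∈ → nonneg x (proj₁ x∈))

      S-off : ∀ {x} → S x → ∀ i → lookup J i ≡ false → lookup x i ≡ 0ℚ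
      S-off (y , (_ , y-off) , refl) i i∉J =
        trans (Vec.lookup-map i (K *_) y) (trans (cong (K *_) (y-off i i∉J)) (ℚ.*-zeroʳ K))

      clip∈S : ∀ {p} → ⟦ P ⟧ p → S (K · clipᵥ (indicator J) p)
      clip∈S {p} p∈P = clipᵥ (indicator J) p , (clip∈P full anti (indicator J) p∈P , clip-out J p) , refl

      0∈S : S 0ᵥ
      0∈S = 0ᵥ , (0∈P full anti , λ i _ → lookup-0ᵥ i) , K·0
        where
        K·0 : 0ᵥ ≡ K · 0ᵥ
        K·0 = ext λ i → trans (lookup-0ᵥ i)
          (sym (trans (Vec.lookup-map i (K *_) 0ᵥ) (trans (cong (K *_) (lookup-0ᵥ i)) (ℚ.*-zeroʳ K))))

      -- If some p in `P` has a positive i-th coordinate, let s be its scaled projection to the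
      -- face. Then x - c s stays in the face, hence is nonnegative, and the i-th coordinate of x is
      -- at least that of c s. If there is no such p, the i-th coordinate vanishes on `P`, against
      -- full dimension.
      relint-pos : ∀ {x} → RelInt S x → ∀ i → lookup J i ≡ true → 0ℚ < lookup x i
      relint-pos {x} x∈ i i∈J = decidable-stable (0ℚ ℚ.<? lookup x i) λ 0≮xᵢ →
        contradiction (trans (sym (aff-⊥ {w = unit i} (λ {p} p∈ → P-zero 0≮xᵢ p p∈) (full (unit i)))) unit-unit) λ ()
        where
        unit-unit : ⟨ unit i , unit i ⟩ ≡ 1ℚ
        unit-unit = trans (dot-unit (unit i) i) (lookup-unit i)
          where
          lookup-unit : ∀ {n} (i : Fin n) → lookup (unit i) i ≡ 1ℚ
          lookup-unit zero = refl
          lookup-unit (suc i) = lookup-unit i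

        P-zero : ¬ 0ℚ < lookup x i → ∀ p → ⟦ P ⟧ p → ⟨ unit i , p ⟩ ≡ 0ℚ
        P-zero 0≮xᵢ p p∈ = trans (dot-comm (unit i) p) (trans (dot-unit p i) (ℚ.≤-antisym (ℚ.≮⇒≥ 0≮pᵢ) (nonneg p p∈ i)))
          where
          s = K · clipᵥ (indicator J) p
          sᵢ≡ : lookup s i ≡ K * lookup p i
          sᵢ≡ = trans (Vec.lookup-map i (K *_) (clipᵥ (indicator J) p)) (cong (K *_) (clip-in J p i i∈J))
          move = relint-move {S = S} x∈ 0∈S (clip∈S p∈)
          c = proj₁ move
          0<c = proj₁ (proj₂ move)
          step : ∀ x c s → x ≡ c * s + (x + - c * s)
          step = solve-∀ ℚ-ring
          0≮pᵢ : ¬ 0ℚ < lookup p i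
          0≮pᵢ 0<pᵢ = 0≮xᵢ (ℚ.<-≤-trans (*-pos 0<c (subst (0ℚ <_) (sym sᵢ≡) (*-pos 0<K 0<pᵢ)))
            (≤-offset (subst (0ℚ ≤_) (lookup-ray x (- c) s i) (S-nonneg (proj₂ (proj₂ (proj₂ move))) i))
              (step (lookup x i) c (lookup s i))))

    relint⇒inner : ∀ z → RelInt S (toℚᵥ z) → Positive-on J z × Zero-off J z × ⟦ P ⟧ (r · toℚᵥ z)
    relint⇒inner z z∈ =
      (λ i i∈J → ℤ.i<j⇒suc[i]≤j (ι-cancel-< {0ℤ} (subst (0ℚ <_) (lookup-toℚᵥ z i) (relint-pos z∈ i i∈J)))) ,
      (λ i i∉J → ι-injective (trans (sym (lookup-toℚᵥ z i)) (S-off (proj₁ z∈) i i∉J))) ,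
      integral-gap full anti integral k 0<r rk≡1 (proj₁ (proj₂ move)) z (S-nonneg (proj₁ z∈))
        (forget (proj₁ (proj₂ (proj₂ move))))
      where
      -- The direction is the point itself, so the forward endpoint is (1 + c)z.
      move = relint-move {S = S} z∈ 0∈S (proj₁ z∈)
      forget : ∀ {x} → S x → Scale K ⟦ P ⟧ x
      forget (y , y∈ , eq) = y , proj₁ y∈ , eq

    inner⇒relint : ∀ z → Positive-on J z → Zero-off J z → ⟦ P ⟧ (r · toℚᵥ z) → RelInt S (toℚᵥ z)
    inner⇒relint z 1≤z z-off rz∈P =
      dominated∈S x 0≤x x-off (λ i → ≤-offset (*-nonneg (ℚ.<⇒≤ 0<r) (0≤x i)) refl) , r , 0<r , near
      where
      x = toℚᵥ z
      q = proj₁ (reciprocal 0<K)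
      0<q = proj₁ (proj₂ (reciprocal 0<K))
      qK≡1 = proj₂ (proj₂ (reciprocal 0<K))

      x-off : ∀ i → lookup J i ≡ false → lookup x i ≡ 0ℚ
      x-off i i∉J = trans (lookup-toℚᵥ z i) (cong ι (z-off i i∉J))

      0≤x : NonNeg x
      0≤x i = nonneg-entry (lookup J i) refl
        where
        nonneg-entry : ∀ b → lookup J i ≡ b → 0ℚ ≤ lookup x i
        nonneg-entry true i∈J = subst (0ℚ ≤_) (sym (lookup-toℚᵥ z i))
          (ι-mono-≤ {0ℤ} (ℤ.≤-trans (ℤ.+≤+ ℕ.z≤n) (1≤z i i∈J)))
        nonneg-entry false i∉J = ℚ.≤-reflexive (sym (x-off i i∉J))

      -- With q = 1/(k + 1) and r = 1/k this is (1 + 1/k)/(k + 1) = 1/k: the point (1 + 1/k)z of the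
      -- larger dilate rescales to the same point of `P` as `z` in the smaller one.
      q*[x+rx]≡rx : ∀ x → q * (x + r * x) ≡ r * x
      q*[x+rx]≡rx x = begin
        q * (x + r * x)             ≡⟨ cong (λ t → q * (t + r * x)) (ℚ.*-identityˡ x) ⟨
        q * (1ℚ * x + r * x)        ≡⟨ cong (λ t → q * (t * x + r * x)) rk≡1 ⟨
        q * (r * ℕtoℚ k * x + r * x)  ≡⟨ regroup q r (ℕtoℚ k) x ⟩
        q * (ℕtoℚ k + 1ℚ) * (r * x)   ≡⟨ cong (λ t → q * t * (r * x)) K≡k+1 ⟨
        q * K * (r * x)             ≡⟨ cong (_* (r * x)) qK≡1 ⟩
        1ℚ * (r * x)                ≡⟨ ℚ.*-identityˡ (r * x) ⟩
        r * x                       ∎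
        where
        open ≡-Reasoning
        regroup : ∀ q r k x → q * (r * k * x + r * x) ≡ q * (k + 1ℚ) * (r * x)
        regroup = solve-∀ ℚ-ring

      dominated∈S : ∀ y → NonNeg y → (∀ i → lookup J i ≡ false → lookup y i ≡ 0ℚ) →
        (∀ i → lookup y i ≤ lookup x i + r * lookup x i) → S y
      dominated∈S y 0≤y y-off y≤ = q · y ,
        (down (q · y) (r · x) rz∈P
          (λ i → subst (0ℚ ≤_) (sym (Vec.lookup-map i (q *_) y)) (*-nonneg (ℚ.<⇒≤ 0<q) (0≤y i)))
          (λ i → subst₂ _≤_ (sym (Vec.lookup-map i (q *_) y))
            (trans (q*[x+rx]≡rx (lookup x i)) (sym (Vec.lookup-map i (r *_) x)))
            (*-monoʳ-≤ (ℚ.<⇒≤ 0<q) (y≤ i))) ,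
         λ i i∉J → trans (Vec.lookup-map i (q *_) y) (trans (cong (q *_) (y-off i i∉J)) (ℚ.*-zeroʳ q))) ,
        ·-cancel q K qK≡1 y

      -- The radius 1/k works in both directions since coordinates on `J` are at least 1: 1/k ≤ 1 ≤
      -- xᵢ keeps yᵢ nonnegative, and 1/k ≤ xᵢ/k keeps yᵢ below (1 + 1/k)xᵢ. Off `J`, the affine
      -- hull forces yᵢ = 0.
      near : ∀ y → Aff S y → (∀ i → ∣ lookup x i - lookup y i ∣ < r) → S y
      near y y∈ ∣x-y∣<r = dominated∈S y (λ i → lower i (lookup J i) refl) y-off (λ i → upper i (lookup J i) refl)
        where
        y-off : ∀ i → lookup J i ≡ false → lookup y i ≡ 0ℚ
        y-off i i∉J = trans (sym (dot-unit y i)) (trans (dot-comm y (unit i)) (aff-⊥ {S = S} {w = unit i}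
          (λ {p} p∈ → trans (dot-comm (unit i) p) (trans (dot-unit p i) (S-off p∈ i i∉J))) y∈))

        r≤rx : ∀ i → lookup J i ≡ true → r ≤ r * lookup x i
        r≤rx i i∈J = subst (_≤ r * lookup x i) (ℚ.*-identityʳ r)
          (*-monoʳ-≤ (ℚ.<⇒≤ 0<r) (subst (1ℚ ≤_) (sym (lookup-toℚᵥ z i)) (ι-mono-≤ (1≤z i i∈J))))

        r≤x : ∀ i → lookup J i ≡ true → r ≤ lookup x i
        r≤x i i∈J = ℚ.≤-trans (subst₂ _≤_ (ℚ.*-identityʳ r) rk≡1 (*-monoʳ-≤ (ℚ.<⇒≤ 0<r) 1≤k))
          (subst (1ℚ ≤_) (sym (lookup-toℚᵥ z i)) (ι-mono-≤ (1≤z i i∈J)))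

        step : ∀ x y r → y ≡ (x + - r) + (r - (x - y))
        step = solve-∀ ℚ-ring
        step′ : ∀ x y r → x + r ≡ y + (r - (- (x - y)))
        step′ = solve-∀ ℚ-ring

        lower : ∀ i b → lookup J i ≡ b → 0ℚ ≤ lookup y i
        lower i false i∉J = ℚ.≤-reflexive (sym (y-off i i∉J))
        lower i true i∈J = ℚ.≤-trans (≤⇒0≤- (r≤x i i∈J))
          (≤-offset (≤⇒0≤- (ℚ.≤-trans (≤∣∣ _) (ℚ.<⇒≤ (∣x-y∣<r i)))) (step (lookup x i) (lookup y i) r))

        upper : ∀ i b → lookup J i ≡ b → lookup y i ≤ lookup x i + r * lookup x i
        upper i false i∉J = subst (_≤ lookup x i + r * lookup x i) (sym (y-off i i∉J))
          (+-nonneg (0≤x i) (*-nonneg (ℚ.<⇒≤ 0<r) (0≤x i)))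
        upper i true i∈J = ℚ.≤-trans
          (≤-offset (≤⇒0≤- (ℚ.≤-trans (-≤∣∣ _) (ℚ.<⇒≤ (∣x-y∣<r i)))) (step′ (lookup x i) (lookup y i) r))
          (ℚ.+-monoʳ-≤ (lookup x i) (r≤rx i i∈J))

  -- Counting

  allSubsets-complete : (J : Vec Bool n) → J ∈ allSubsets n
  allSubsets-complete [] = here refl
  allSubsets-complete (true ∷ J) = ∈-++⁺ˡ (∈-map⁺ (true ∷_) (allSubsets-complete J))
  allSubsets-complete (false ∷ J) = ∈-++⁺ʳ _ (∈-map⁺ (false ∷_) (allSubsets-complete J))

  allSubsets-unique : ∀ n → Unique (allSubsets n)
  allSubsets-unique zero = [] ∷ []
  allSubsets-unique (suc n) = Unique.++⁺
    (Unique.map⁺ Vec.∷-injectiveʳ (allSubsets-unique n))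
    (Unique.map⁺ Vec.∷-injectiveʳ (allSubsets-unique n))
    λ (v∈true , v∈false) → disjoint (∈-map⁻ (true ∷_) v∈true) (∈-map⁻ (false ∷_) v∈false)
    where
    disjoint : ∀ {v} → ∃ (λ x → x ∈ allSubsets n × v ≡ true ∷ x) → ¬ ∃ (λ x → x ∈ allSubsets n × v ≡ false ∷ x)
    disjoint (_ , _ , refl) (_ , _ , ())

  module _ {I X : Set} (F : I → List X) where

    -- The tag `i` keeps entries distinct even if the lists `F i` overlap, so the length is a sum
    -- over the indices.
    dependentPairs : List I → List (I × X)
    dependentPairs [] = []
    dependentPairs (i ∷ is) = List.map (i ,_) (F i) ++ dependentPairs is

    ∈-dependentPairs⁺ : ∀ {is i x} → i ∈ is → x ∈ F i → (i , x) ∈ dependentPairs is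
    ∈-dependentPairs⁺ {i ∷ is} (here refl) x∈ = ∈-++⁺ˡ (∈-map⁺ (i ,_) x∈)
    ∈-dependentPairs⁺ {i ∷ is} (there i∈) x∈ = ∈-++⁺ʳ (List.map (i ,_) (F i)) (∈-dependentPairs⁺ i∈ x∈)

    ∈-dependentPairs⁻ : ∀ is {i x} → (i , x) ∈ dependentPairs is → i ∈ is × x ∈ F i
    ∈-dependentPairs⁻ (i ∷ is) ix∈ with ∈-++⁻ (List.map (i ,_) (F i)) ix∈
    ... | inj₁ ix∈head with ∈-map⁻ (i ,_) ix∈head
    ...   | x , x∈ , refl = here refl , x∈
    ∈-dependentPairs⁻ (i ∷ is) ix∈ | inj₂ ix∈tail with ∈-dependentPairs⁻ is ix∈tail
    ...   | i∈ , x∈ = there i∈ , x∈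

    dependentPairs-unique : (∀ i → Unique (F i)) → ∀ {is} → Unique is → Unique (dependentPairs is)
    dependentPairs-unique F! [] = []
    dependentPairs-unique F! {i ∷ is} (i∉is ∷ is!) = Unique.++⁺
      (Unique.map⁺ (cong proj₂) (F! i)) (dependentPairs-unique F! is!)
      λ (v∈head , v∈tail) → disjoint (∈-map⁻ (i ,_) v∈head) v∈tail
      where
      disjoint : ∀ {v} → ∃ (λ x → x ∈ F i × v ≡ (i , x)) → ¬ v ∈ dependentPairs is
      disjoint (_ , _ , refl) v∈tail = All.lookup i∉is (proj₁ (∈-dependentPairs⁻ is v∈tail)) refl

    length-dependentPairs : ∀ is → length (dependentPairs is) ≡ ℕ.sum (List.map (length ∘ F) is)
    length-dependentPairs [] = refl
    length-dependentPairs (i ∷ is) = trans (length-++ (List.map (i ,_) (F i)))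
      (cong₂ ℕ._+_ (length-map (i ,_) (F i)) (length-dependentPairs is))

  length-cartesianProduct : {X Y : Set} (xs : List X) (ys : List Y) →
    length (cartesianProduct xs ys) ≡ length xs ℕ.* length ys
  length-cartesianProduct [] ys = refl
  length-cartesianProduct (x ∷ xs) ys = trans (length-++ (List.map (x ,_) ys))
    (cong₂ ℕ._+_ (length-map (x ,_) ys) (length-cartesianProduct xs ys))

  -- The left inverse is asked for only on the list, because `split` undoes subtraction only on
  -- triples satisfying `Split`.
  map-unique : {X Y : Set} (f : X → Y) (g : Y → X) → ∀ {xs} → (∀ {x} → x ∈ xs → g (f x) ≡ x) →
    Unique xs → Unique (List.map f xs)
  map-unique f g {[]} _ [] = []
  map-unique f g {x ∷ xs} gf (x∉xs ∷ xs!) = All.tabulate fresh ∷ map-unique f g (gf ∘ there) xs!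
    where
    fresh : ∀ {y} → y ∈ List.map f xs → f x ≢ y
    fresh y∈ fx≡y with ∈-map⁻ f y∈
    ... | x′ , x′∈ , refl = All.lookup x∉xs x′∈
      (trans (sym (gf (here refl))) (trans (cong g fx≡y) (gf (there x′∈))))

  HasCard-resp : ∀ {L M : Pred (Vec ℤ n) 0ℓ} {N} → (∀ z → L z → M z) → (∀ z → M z → L z) → HasCard L N → HasCard M N
  HasCard-resp L⊆M M⊆L (xs , len , xs! , L⇔) = xs , len , xs! , λ z →
    mk⇔ (Equivalence.to (L⇔ z) ∘ M⊆L z) (L⊆M z ∘ Equivalence.from (L⇔ z))

  -- Positive and negative parts of lattice points

  isPos : ℤ → Bool
  isPos ℤ.+[1+ _ ] = true
  isPos _ = false

  pos neg : ℤ → ℤ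
  pos (ℤ.+ n) = ℤ.+ n
  pos ℤ.-[1+ _ ] = 0ℤ
  neg (ℤ.+ _) = 0ℤ
  neg ℤ.-[1+ n ] = ℤ.+[1+ n ]

  pos-neg : ∀ z → pos z ℤ.- neg z ≡ z
  pos-neg (ℤ.+ n) = ℤ.+-identityʳ (ℤ.+ n)
  pos-neg ℤ.-[1+ n ] = refl

  _-ᶻ_ : Vec ℤ n → Vec ℤ n → Vec ℤ n
  _-ᶻ_ = Vec.zipWith ℤ._-_

  pos-negᵥ : (z : Vec ℤ n) → Vec.map pos z -ᶻ Vec.map neg z ≡ z
  pos-negᵥ [] = refl
  pos-negᵥ (z ∷ zs) = cong₂ _∷_ (pos-neg z) (pos-negᵥ zs)

  -- `isPos` is false at 0, so zero coordinates go to the complement of J and each point belongs to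
  -- exactly one J.
  split : Vec ℤ n → Vec Bool n × Vec ℤ n × Vec ℤ n
  split z = Vec.map isPos z , Vec.map pos z , Vec.map neg z

  Split : Vec Bool n → Vec ℤ n → Vec ℤ n → Set
  Split J x y = ∀ i → (lookup J i ≡ true × 1ℤ ℤ.≤ lookup x i × lookup y i ≡ 0ℤ) ⊎
                      (lookup J i ≡ false × lookup x i ≡ 0ℤ × 0ℤ ℤ.≤ lookup y i)

  split-difference : ∀ {J : Vec Bool n} {x y} → Split J x y → split (x -ᶻ y) ≡ (J , x , y)
  split-difference {J = J} {x} {y} s =
    cong₂ _,_ (map≡ isPos J (proj₁ ∘ point))
      (cong₂ _,_ (map≡ pos x (proj₁ ∘ proj₂ ∘ point)) (map≡ neg y (proj₂ ∘ proj₂ ∘ point)))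
    where
    entry : ∀ {j a b} → (j ≡ true × 1ℤ ℤ.≤ a × b ≡ 0ℤ) ⊎ (j ≡ false × a ≡ 0ℤ × 0ℤ ℤ.≤ b) →
      isPos (a ℤ.- b) ≡ j × pos (a ℤ.- b) ≡ a × neg (a ℤ.- b) ≡ b
    entry {a = ℤ.+[1+ m ]} (inj₁ (refl , _ , refl)) = refl , cong ℤ.+[1+_] (ℕ.+-identityʳ m) , refl
    entry {a = ℤ.+ zero} (inj₁ (refl , ℤ.+≤+ () , refl))
    entry {b = ℤ.+ zero} (inj₂ (refl , refl , _)) = refl , refl , refl
    entry {b = ℤ.+[1+ m ]} (inj₂ (refl , refl , _)) = refl , refl , refl

    point : ∀ i → isPos (lookup x i ℤ.- lookup y i) ≡ lookup J i ×
      pos (lookup x i ℤ.- lookup y i) ≡ lookup x i × neg (lookup x i ℤ.- lookup y i) ≡ lookup y i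
    point i = entry (s i)

    map≡ : ∀ {A : Set} (f : ℤ → A) (v : Vec A _) → (∀ i → f (lookup x i ℤ.- lookup y i) ≡ lookup v i) →
      Vec.map f (x -ᶻ y) ≡ v
    map≡ f v eq = ext λ i → trans (Vec.lookup-map i f (x -ᶻ y)) (trans (cong f (Vec.lookup-zipWith ℤ._-_ i x y)) (eq i))

  -- Subtraction is a bijection from the triples (J, x, y) onto `L` with inverse `split`: `apart`
  -- makes it surjective, and the `Split` half of `together` makes it injective.
  card-split : ∀ {A B : Vec Bool n → Pred (Vec ℤ n) 0ℓ} {L : Pred (Vec ℤ n) 0ℓ} (c d : Vec Bool n → ℕ) →
    (∀ J → HasCard (A J) (c J)) → (∀ J → HasCard (B J) (d J)) →
    (∀ z → L z → A (Vec.map isPos z) (Vec.map pos z) × B (Vec.map isPos z) (Vec.map neg z)) →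
    (∀ J x y → A J x → B J y → Split J x y × L (x -ᶻ y)) →
    HasCard L (sumSubsets n (λ J → c J ℕ.* d J))
  card-split {n} {A} {B} {L} c d cardA cardB apart together =
    List.map join triples , len , map-unique join split split-join triples-unique , λ z → mk⇔ (to z) (from z)
    where
    join : Vec Bool n × Vec ℤ n × Vec ℤ n → Vec ℤ n
    join (_ , x , y) = x -ᶻ y

    pairs : Vec Bool n → List (Vec ℤ n × Vec ℤ n)
    pairs J = cartesianProduct (proj₁ (cardA J)) (proj₁ (cardB J))

    triples = dependentPairs pairs (allSubsets n)

    triples-unique : Unique triples
    triples-unique = dependentPairs-unique pairs
      (λ J → Unique.cartesianProduct⁺ (proj₁ (proj₂ (proj₂ (cardA J)))) (proj₁ (proj₂ (proj₂ (cardB J)))))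
      (allSubsets-unique n)

    triple⁻ : ∀ {J x y} → (J , x , y) ∈ triples → A J x × B J y
    triple⁻ {J} {x} {y} t∈ = Equivalence.from (proj₂ (proj₂ (proj₂ (cardA J))) x) (proj₁ xy∈) ,
                             Equivalence.from (proj₂ (proj₂ (proj₂ (cardB J))) y) (proj₂ xy∈)
      where
      xy∈ = ∈-cartesianProduct⁻ (proj₁ (cardA J)) (proj₁ (cardB J)) (proj₂ (∈-dependentPairs⁻ pairs (allSubsets n) t∈))

    triple⁺ : ∀ {J x y} → A J x → B J y → (J , x , y) ∈ triples
    triple⁺ {J} {x} {y} x∈ y∈ = ∈-dependentPairs⁺ pairs (allSubsets-complete J)
      (∈-cartesianProduct⁺ (Equivalence.to (proj₂ (proj₂ (proj₂ (cardA J))) x) x∈)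
                           (Equivalence.to (proj₂ (proj₂ (proj₂ (cardB J))) y) y∈))

    split-join : ∀ {t} → t ∈ triples → split (join t) ≡ t
    split-join {J , x , y} t∈ = split-difference (proj₁ (together J x y (proj₁ (triple⁻ t∈)) (proj₂ (triple⁻ t∈))))

    to : ∀ z → L z → z ∈ List.map join triples
    to z z∈ = subst (_∈ List.map join triples) (pos-negᵥ z)
      (∈-map⁺ join (triple⁺ (proj₁ (apart z z∈)) (proj₂ (apart z z∈))))

    from : ∀ z → z ∈ List.map join triples → L z
    from z z∈ with ∈-map⁻ join z∈
    ... | (J , x , y) , t∈ , refl = proj₂ (together J x y (proj₁ (triple⁻ t∈)) (proj₂ (triple⁻ t∈)))

    len : length (List.map join triples) ≡ sumSubsets n (λ J → c J ℕ.* d J)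
    len = trans (length-map join triples) (trans (length-dependentPairs pairs (allSubsets n))
      (cong ℕ.sum (map-cong (λ J → trans (length-cartesianProduct (proj₁ (cardA J)) (proj₁ (cardB J)))
        (cong₂ ℕ._*_ (proj₁ (proj₂ (cardA J))) (proj₁ (proj₂ (cardB J))))) (allSubsets n))))

  -- Enumerating the lattice points of a dilate

  box : ∀ n → ℕ → List (Vec ℤ n)
  box zero N = [] ∷ []
  box (suc n) N = cartesianProductWith _∷_ (List.map ℤ.+_ (upTo (suc N))) (box n N)

  box-unique : ∀ n N → Unique (box n N)
  box-unique zero N = [] ∷ []
  box-unique (suc n) N = Unique.cartesianProductWith⁺ _∷_ Vec.∷-injective
    (Unique.map⁺ ℤ.+-injective (Unique.upTo⁺ (suc N))) (box-unique n N)

  ∈-box : ∀ {N} (z : Vec ℤ n) → (∀ i → 0ℤ ℤ.≤ lookup z i) → (∀ i → lookup z i ℤ.≤ ℤ.+ N) → z ∈ box n N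
  ∈-box [] _ _ = here refl
  ∈-box {N = N} (z ∷ zs) 0≤z z≤N =
    ∈-cartesianProductWith⁺ _∷_ (entry (0≤z zero) (z≤N zero)) (∈-box zs (0≤z ∘ suc) (z≤N ∘ suc))
    where
    entry : ∀ {z} → 0ℤ ℤ.≤ z → z ℤ.≤ ℤ.+ N → z ∈ List.map ℤ.+_ (upTo (suc N))
    entry (ℤ.+≤+ _) (ℤ.+≤+ m≤N) = ∈-map⁺ ℤ.+_ (∈-upTo⁺ (ℕ.s≤s m≤N))

  bounded-card : ∀ {L : Pred (Vec ℤ n) 0ℓ} N → Decidable L →
    (∀ z → L z → ∀ i → 0ℤ ℤ.≤ lookup z i × lookup z i ℤ.≤ ℤ.+ N) →
    ∃ (HasCard L)
  bounded-card {n} {L} N L? bound = _ , filter L? (box n N) , refl , Unique.filter⁺ L? (box-unique n N) , λ z →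
    mk⇔ (λ z∈ → ∈-filter⁺ L? (∈-box z (proj₁ ∘ bound z z∈) (proj₂ ∘ bound z z∈)) z∈)
        (λ z∈ → proj₂ (∈-filter⁻ L? {xs = box n N} z∈))

  -- Not the true ceiling but the absolute value of the numerator, an upper bound because the
  -- denominator is at least 1.
  ceil : ℚ → ℕ
  ceil p = ℤ.∣ ↥ p ∣

  ≤-ceil : ∀ p → p ≤ ℕtoℚ (ceil p)
  ≤-ceil p@(mkℚ (ℤ.+ m) d c) = subst (p ≤_) (sym (ι≡mkℚ (ℤ.+ m)))
    (*≤* (ℤ.*-monoˡ-≤-nonNeg (ℤ.+ m) (ℤ.+≤+ (ℕ.s≤s ℕ.z≤n))))
  ≤-ceil p@(mkℚ ℤ.-[1+ m ] d c) = subst (p ≤_) (sym (ι≡mkℚ (ℤ.+ suc m))) (*≤* ℤ.-≤+)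

  ceilᵥ : Point n → ℕ
  ceilᵥ = Vec.foldr′ (λ p m → ceil p ℕ.+ m) 0

  ≤-ceilᵥ : (x : Point n) (i : Fin n) → lookup x i ≤ ℕtoℚ (ceilᵥ x)
  ≤-ceilᵥ (p ∷ x) zero = ℚ.≤-trans (≤-ceil p) (ι-mono-≤ (ℤ.+≤+ (ℕ.m≤m+n (ceil p) (ceilᵥ x))))
  ≤-ceilᵥ (p ∷ x) (suc i) = ℚ.≤-trans (≤-ceilᵥ x i) (ι-mono-≤ (ℤ.+≤+ (ℕ.m≤n+m (ceilᵥ x) (ceil p))))

  -- Sums of naturals stand in for maxima: only some upper bound on all coordinates is wanted.
  radius : Polytope n → ℕ
  radius = ℕ.sum ∘ List.map ceilᵥ

  vertex-≤-radius : ∀ {P : Polytope n} {v} → v ∈ P → ∀ i → lookup v i ≤ ℕtoℚ (radius P)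
  vertex-≤-radius {P = v ∷ P} (here refl) i = ℚ.≤-trans (≤-ceilᵥ v i) (ι-mono-≤ (ℤ.+≤+ (ℕ.m≤m+n (ceilᵥ v) (radius P))))
  vertex-≤-radius {P = v ∷ P} (there v∈) i = ℚ.≤-trans (vertex-≤-radius v∈ i)
    (ι-mono-≤ (ℤ.+≤+ (ℕ.m≤n+m (radius P) (ceilᵥ v))))

  ≤-radius : ∀ {P : Polytope n} {x} → ⟦ P ⟧ x → ∀ i → lookup x i ≤ ℕtoℚ (radius P)
  ≤-radius {P = P} {x} x∈ i = subst (_≤ ℕtoℚ (radius P)) (trans (dot-comm (unit i) x) (dot-unit x i))
    (conv-dot {w = unit i} (λ {v} v∈ → subst (_≤ ℕtoℚ (radius P)) (sym (trans (dot-comm (unit i) v) (dot-unit v i)))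
      (vertex-≤-radius v∈ i)) x∈)

  module _ {n} {P : Polytope n} (anti : AntiBlocking P) (k : ℕ) (r : ℚ) (rk≡1 : r * ℕtoℚ k ≡ 1ℚ) where

    private
      0≤k : 0ℚ ≤ ℕtoℚ k
      0≤k = ι-mono-≤ {0ℤ} {ℤ.+ k} (ℤ.+≤+ ℕ.z≤n)

      entry : ∀ (z : Vec ℤ n) i → ι (lookup z i) ≡ ℕtoℚ k * lookup (r · toℚᵥ z) i
      entry z i = trans (sym (lookup-toℚᵥ z i)) (trans (cong (λ v → lookup v i) (·-cancel r (ℕtoℚ k) rk≡1 (toℚᵥ z)))
        (Vec.lookup-map i (ℕtoℚ k *_) (r · toℚᵥ z)))

    lattice-nonneg : ∀ z → ⟦ P ⟧ (r · toℚᵥ z) → ∀ i → 0ℤ ℤ.≤ lookup z i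
    lattice-nonneg z z∈ i = ι-cancel-≤ (subst (0ℚ ≤_) (sym (entry z i)) (*-nonneg 0≤k (proj₁ anti _ z∈ i)))

    lattice-bound : ∀ z → ⟦ P ⟧ (r · toℚᵥ z) → ∀ i → lookup z i ℤ.≤ ℤ.+ (k ℕ.* radius P)
    lattice-bound z z∈ i = ι-cancel-≤ (subst₂ _≤_ (sym (entry z i))
      (trans (sym (ι-* (ℤ.+ k) (ℤ.+ radius P))) (cong ι (sym (ℤ.pos-* k (radius P)))))
      (*-monoʳ-≤ 0≤k (≤-radius {P = P} z∈ i)))

    lattice-card : ∀ {Q : Pred (Vec ℤ n) 0ℓ} → Decidable Q → ∃ (HasCard (λ z → Q z × ⟦ P ⟧ (r · toℚᵥ z)))
    lattice-card Q? = bounded-card (k ℕ.* radius P) (λ z → Q? z ×-dec conv? P (r · toℚᵥ z))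
      λ z (_ , z∈) i → lattice-nonneg z z∈ i , lattice-bound z z∈ i

    restrict⇒lattice : ∀ J z → Scale (ℕtoℚ k) (Restrict ⟦ P ⟧ J) (toℚᵥ z) → Zero-off J z × ⟦ P ⟧ (r · toℚᵥ z)
    restrict⇒lattice J z z∈ = z-off , proj₁ rz∈
      where
      rz∈ : Restrict ⟦ P ⟧ J (r · toℚᵥ z)
      rz∈ = unscale {r = r} rk≡1 {S = Restrict ⟦ P ⟧ J} z∈
      z-off : Zero-off J z
      z-off i i∉J = ι-injective (trans (entry z i) (trans (cong (ℕtoℚ k *_) (proj₂ rz∈ i i∉J)) (ℚ.*-zeroʳ (ℕtoℚ k))))

    lattice⇒restrict : ∀ J z → Zero-off J z → ⟦ P ⟧ (r · toℚᵥ z) → Scale (ℕtoℚ k) (Restrict ⟦ P ⟧ J) (toℚᵥ z)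
    lattice⇒restrict J z z-off rz∈ = r · toℚᵥ z , (rz∈ , λ i i∉J → trans (Vec.lookup-map i (r *_) (toℚᵥ z))
      (trans (cong (r *_) (trans (lookup-toℚᵥ z i) (cong ι (z-off i i∉J)))) (ℚ.*-zeroʳ r))) ,
      ·-cancel r (ℕtoℚ k) rk≡1 (toℚᵥ z)

    dominated : 0ℚ < r → ∀ {p} z → Scale (ℕtoℚ k) ⟦ P ⟧ p →
      (∀ i → 0ℤ ℤ.≤ lookup z i) → (∀ i → ι (lookup z i) ≤ lookup p i) →
      ⟦ P ⟧ (r · toℚᵥ z)
    dominated 0<r {p} z p∈ 0≤z z≤p = proj₂ anti (r · toℚᵥ z) (r · p) (unscale {r = r} rk≡1 {S = ⟦ P ⟧} p∈)
      (λ i → subst (0ℚ ≤_) (sym (rz i)) (*-nonneg (ℚ.<⇒≤ 0<r) (ι-mono-≤ (0≤z i))))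
      (λ i → subst₂ _≤_ (sym (rz i)) (sym (Vec.lookup-map i (r *_) p)) (*-monoʳ-≤ (ℚ.<⇒≤ 0<r) (z≤p i)))
      where
      rz : ∀ i → lookup (r · toℚᵥ z) i ≡ r * ι (lookup z i)
      rz i = trans (Vec.lookup-map i (r *_) (toℚᵥ z)) (cong (r *_) (lookup-toℚᵥ z i))

  -- Splitting the points of the Minkowski difference

  pos-nonneg : ∀ z → 0ℤ ℤ.≤ pos z
  pos-nonneg (ℤ.+ _) = ℤ.+≤+ ℕ.z≤n
  pos-nonneg ℤ.-[1+ _ ] = ℤ.+≤+ ℕ.z≤n

  neg-nonneg : ∀ z → 0ℤ ℤ.≤ neg z
  neg-nonneg (ℤ.+ _) = ℤ.+≤+ ℕ.z≤n
  neg-nonneg ℤ.-[1+ _ ] = ℤ.+≤+ ℕ.z≤n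

  ι-neg : ∀ z → ι (ℤ.- z) ≡ - ι z
  ι-neg (ℤ.+ zero) = refl
  ι-neg ℤ.+[1+ n ] = refl
  ι-neg ℤ.-[1+ n ] = sym (neg-involutive (ι ℤ.+[1+ n ]))

  -- Since p = z + q ≥ z and p ≥ 0. Together with `neg-≤` this says that the positive and negative
  -- parts are the least way to write `z` as a difference of nonnegative numbers, which is how
  -- anti-blocking puts them into the two polytopes.
  pos-≤ : ∀ z {p q} → 0ℚ ≤ p → 0ℚ ≤ q → ι z ≡ p - q → ι (pos z) ≤ p
  pos-≤ (ℤ.+ n) {p} {q} 0≤p 0≤q eq = ≤-offset 0≤q (trans (step p q) (cong (_+ q) (sym eq)))
    where
    step : ∀ p q → p ≡ (p - q) + q
    step = solve-∀ ℚ-ring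
  pos-≤ ℤ.-[1+ _ ] 0≤p _ _ = 0≤p

  neg-≤ : ∀ z {p q} → 0ℚ ≤ p → 0ℚ ≤ q → ι z ≡ p - q → ι (neg z) ≤ q
  neg-≤ (ℤ.+ _) _ 0≤q _ = 0≤q
  neg-≤ z@(ℤ.-[1+ _ ]) {p} {q} 0≤p 0≤q eq =
    ≤-offset 0≤p (trans (step p q) (trans (cong (λ t → - t + p) (sym eq)) (cong (_+ p) (sym (ι-neg z)))))
    where
    step : ∀ p q → q ≡ - (p - q) + p
    step = solve-∀ ℚ-ring

  isPos⇒1≤pos : ∀ z → isPos z ≡ true → 1ℤ ℤ.≤ pos z
  isPos⇒1≤pos ℤ.+[1+ n ] _ = ℤ.+≤+ (ℕ.s≤s ℕ.z≤n)
  isPos⇒1≤pos (ℤ.+ zero) ()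
  isPos⇒1≤pos ℤ.-[1+ n ] ()

  ¬isPos⇒pos≡0 : ∀ z → isPos z ≡ false → pos z ≡ 0ℤ
  ¬isPos⇒pos≡0 (ℤ.+ zero) _ = refl
  ¬isPos⇒pos≡0 ℤ.-[1+ _ ] _ = refl

  isPos⇒neg≡0 : ∀ z → not (isPos z) ≡ false → neg z ≡ 0ℤ
  isPos⇒neg≡0 (ℤ.+ _) _ = refl

  toℚᵥ-difference : (x y : Vec ℤ n) → toℚᵥ (x -ᶻ y) ≡ toℚᵥ x -ᵥ toℚᵥ y
  toℚᵥ-difference [] [] = refl
  toℚᵥ-difference (x ∷ xs) (y ∷ ys) = cong₂ _∷_ (trans (ι-+ x (ℤ.- y)) (cong (ι x +_) (ι-neg y)))
    (toℚᵥ-difference xs ys)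

  module _ {n} {P₁ P₂ : Polytope n} (anti₁ : AntiBlocking P₁) (anti₂ : AntiBlocking P₂)
    (a b : ℕ) (r s : ℚ) (0<r : 0ℚ < r) (ra≡1 : r * ℕtoℚ a ≡ 1ℚ) (0<s : 0ℚ < s) (sb≡1 : s * ℕtoℚ b ≡ 1ℚ) where

    private
      A B : Vec Bool n → Pred (Vec ℤ n) 0ℓ
      A J x = (Positive-on J x × Zero-off J x) × ⟦ P₁ ⟧ (r · toℚᵥ x)
      B J y = Zero-off (complement J) y × ⟦ P₂ ⟧ (s · toℚᵥ y)

      D : PSet n
      D = MinkDiff (Scale (ℕtoℚ a) ⟦ P₁ ⟧) (Scale (ℕtoℚ b) ⟦ P₂ ⟧)

    split-lattice : ∀ z → D (toℚᵥ z) → A (Vec.map isPos z) (Vec.map pos z) × B (Vec.map isPos z) (Vec.map neg z)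
    split-lattice z (p , q , p∈ , q∈ , eq) = ((1≤pos , pos-off) , pos∈) , neg-off , neg∈
      where
      0≤p : NonNeg p
      0≤p = scale-nonneg {S = ⟦ P₁ ⟧} (ι-mono-≤ {0ℤ} {ℤ.+ a} (ℤ.+≤+ ℕ.z≤n)) (proj₁ anti₁) p∈
      0≤q : NonNeg q
      0≤q = scale-nonneg {S = ⟦ P₂ ⟧} (ι-mono-≤ {0ℤ} {ℤ.+ b} (ℤ.+≤+ ℕ.z≤n)) (proj₁ anti₂) q∈
      zᵢ : ∀ i → ι (lookup z i) ≡ lookup p i - lookup q i
      zᵢ i = trans (sym (lookup-toℚᵥ z i)) (trans (cong (λ v → lookup v i) eq) (Vec.lookup-zipWith _-_ i p q))

      J : Vec Bool n
      J = Vec.map isPos z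

      J-entry : ∀ {b} i → lookup J i ≡ b → isPos (lookup z i) ≡ b
      J-entry i = trans (sym (Vec.lookup-map i isPos z))

      posᵢ : ∀ i → lookup (Vec.map pos z) i ≡ pos (lookup z i)
      posᵢ i = Vec.lookup-map i pos z

      negᵢ : ∀ i → lookup (Vec.map neg z) i ≡ neg (lookup z i)
      negᵢ i = Vec.lookup-map i neg z

      1≤pos : Positive-on J (Vec.map pos z)
      1≤pos i i∈J = subst (1ℤ ℤ.≤_) (sym (posᵢ i)) (isPos⇒1≤pos (lookup z i) (J-entry i i∈J))

      pos-off : Zero-off J (Vec.map pos z)
      pos-off i i∉J = trans (posᵢ i) (¬isPos⇒pos≡0 (lookup z i) (J-entry i i∉J))

      neg-off : Zero-off (complement J) (Vec.map neg z)
      neg-off i i∉Jᶜ = trans (negᵢ i) (isPos⇒neg≡0 (lookup z i)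
        (trans (cong not (J-entry i refl)) (trans (sym (Vec.lookup-map i not J)) i∉Jᶜ)))

      pos∈ : ⟦ P₁ ⟧ (r · toℚᵥ (Vec.map pos z))
      pos∈ = dominated anti₁ a r ra≡1 0<r (Vec.map pos z) p∈
        (λ i → subst (0ℤ ℤ.≤_) (sym (posᵢ i)) (pos-nonneg (lookup z i)))
        (λ i → subst (λ t → ι t ≤ lookup p i) (sym (posᵢ i)) (pos-≤ (lookup z i) (0≤p i) (0≤q i) (zᵢ i)))

      neg∈ : ⟦ P₂ ⟧ (s · toℚᵥ (Vec.map neg z))
      neg∈ = dominated anti₂ b s sb≡1 0<s (Vec.map neg z) q∈
        (λ i → subst (0ℤ ℤ.≤_) (sym (negᵢ i)) (neg-nonneg (lookup z i)))
        (λ i → subst (λ t → ι t ≤ lookup q i) (sym (negᵢ i)) (neg-≤ (lookup z i) (0≤p i) (0≤q i) (zᵢ i)))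

    join-lattice : ∀ J x y → A J x → B J y → Split J x y × D (toℚᵥ (x -ᶻ y))
    join-lattice J x y ((1≤x , x-off) , x∈) (y-off , y∈) = (λ i → cases i (lookup J i) refl) ,
      toℚᵥ x , toℚᵥ y ,
      (r · toℚᵥ x , x∈ , ·-cancel r (ℕtoℚ a) ra≡1 (toℚᵥ x)) ,
      (s · toℚᵥ y , y∈ , ·-cancel s (ℕtoℚ b) sb≡1 (toℚᵥ y)) ,
      toℚᵥ-difference x y
      where
      cases : ∀ i j → lookup J i ≡ j → (lookup J i ≡ true × 1ℤ ℤ.≤ lookup x i × lookup y i ≡ 0ℤ) ⊎
                      (lookup J i ≡ false × lookup x i ≡ 0ℤ × 0ℤ ℤ.≤ lookup y i)
      cases i true i∈J = inj₁ (i∈J , 1≤x i i∈J , y-off i (trans (Vec.lookup-map i not J) (cong not i∈J)))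
      cases i false i∉J = inj₂ (i∉J , x-off i i∉J , lattice-nonneg anti₂ b s sb≡1 y y∈ i)

  zero-off? : (J : Vec Bool n) → Decidable (Zero-off J)
  zero-off? J z = all? λ i → (lookup J i Bool.≟ false) →-dec (lookup z i ℤ.≟ 0ℤ)

  positive-on? : (J : Vec Bool n) → Decidable (Positive-on J)
  positive-on? J z = all? λ i → (lookup J i Bool.≟ true) →-dec (1ℤ ℤ.≤? lookup z i)

  0<ℕtoℚ : ∀ {k} → 0 ℕ.< k → 0ℚ < ℕtoℚ k
  0<ℕtoℚ {k} 0<k = ℚ.<-≤-trans (ℚ.positive⁻¹ 1ℚ) (ι-mono-≤ {1ℤ} {ℤ.+ k} (ℤ.+≤+ 0<k))

open LatticeSplitting
open import Data.Nat using (_<_; _+_; _*_)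
open import Data.Product using (∃; _,_; proj₁; proj₂)
open import Data.Rational using (0ℚ)
open import Function using (_∘_)
open import Relation.Nullary using (_×-dec_)

theorem3p24 : (n : ℕ) (P₁ P₂ : Polytope n) →
    FullDimensional P₁ → FullDimensional P₂ →
    AntiBlocking P₁ → AntiBlocking P₂ →
    DualIntegral P₁ →
    (a b : ℕ) → 0 < a → 0 < b →
    Σ (Vec Bool n → ℕ) λ c → Σ (Vec Bool n → ℕ) λ d →
    (∀ J → HasCard (Lattice (RelInt (Scale (ℕtoℚ (a + 1)) (Restrict ⟦ P₁ ⟧ J)))) (c J))
    × (∀ J → HasCard (Lattice (Scale (ℕtoℚ b) (Restrict ⟦ P₂ ⟧ (complement J)))) (d J))
    × HasCard (Lattice (MinkDiff (Scale (ℕtoℚ a) ⟦ P₁ ⟧) (Scale (ℕtoℚ b) ⟦ P₂ ⟧)))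
    (sumSubsets n (λ J → c J * d J))
theorem3p24 n P₁ P₂ full₁ full₂ anti₁ anti₂ integral a b 0<a 0<b =
  -- The counts are those of the decidable descriptions below; they are then transferred to the
  -- relative interiors and to the faces.
  proj₁ ∘ cardA , proj₁ ∘ cardB ,
  (λ J → HasCard-resp
    (λ z ((1≤z , z-off) , z∈) → inner⇒relint full₁ anti₁ integral a r 0<r ra≡1 J z 1≤z z-off z∈)
    (λ z z∈ → let 1≤z , z-off , rz∈ = relint⇒inner full₁ anti₁ integral a r 0<r ra≡1 J z z∈ in (1≤z , z-off) , rz∈)
    (proj₂ (cardA J))) ,
  (λ J → HasCard-resp
    (λ z (z-off , z∈) → lattice⇒restrict anti₂ b s sb≡1 (complement J) z z-off z∈)
    (restrict⇒lattice anti₂ b s sb≡1 (complement J))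
    (proj₂ (cardB J))) ,
  card-split (proj₁ ∘ cardA) (proj₁ ∘ cardB) (proj₂ ∘ cardA) (proj₂ ∘ cardB)
    (split-lattice anti₁ anti₂ a b r s 0<r ra≡1 0<s sb≡1)
    (join-lattice anti₁ anti₂ a b r s 0<r ra≡1 0<s sb≡1)
  where
  r = proj₁ (reciprocal (0<ℕtoℚ 0<a))
  0<r = proj₁ (proj₂ (reciprocal (0<ℕtoℚ 0<a)))
  ra≡1 = proj₂ (proj₂ (reciprocal (0<ℕtoℚ 0<a)))
  s = proj₁ (reciprocal (0<ℕtoℚ 0<b))
  0<s = proj₁ (proj₂ (reciprocal (0<ℕtoℚ 0<b)))
  sb≡1 = proj₂ (proj₂ (reciprocal (0<ℕtoℚ 0<b)))
  cardA : ∀ J → ∃ (HasCard (λ x → (Positive-on J x × Zero-off J x) × ⟦ P₁ ⟧ (r · toℚᵥ x)))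
  cardA J = lattice-card anti₁ a r ra≡1 (λ x → positive-on? J x ×-dec zero-off? J x)
  cardB : ∀ J → ∃ (HasCard (λ y → Zero-off (complement J) y × ⟦ P₂ ⟧ (s · toℚᵥ y)))
  cardB J = lattice-card anti₂ b s sb≡1 (zero-off? (complement J))
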